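{- There is a polynomial-time algorithm which, for every instance of the value-dependent DFEP with binary tests ($\ell=2$) and $n$ objects, constructs a decision tree $D$ with $cost_W(D)=O(\log n)\cdot OPT_W(S)$ (namely the algorithm \textsc{DividePairs}, whose output satisfies $cost_W(D)\le H(P(S))\,OPT_W(S)\le 2\ln(n)\,OPT_W(S)$, where $H(k)=\sum_{i=1}^k 1/i$).
   Context: Value-dependent DFEP: $S$ is a finite set of $n$ objects partitioned into classes $C=\{C_1,\dots,C_m\}$; $\mathbf p$ is a probability distribution on $S$; $T$ is a set of tests $t:S\to\{1,\dots,\ell\}$, complete in the sense that any two distinct objects are distinguished by some test; each test $t$ has $\ell$ costs $c^1(t),\dots,c^\ell(t)\in\mathbb{Q}^+$, and applying $t$ to object $s$ costs $c^{t(s)}(t)$. For $G\subseteq S$, $G^i_t=\{s\in G: t(s)=i\}$. A decision tree for $G$ is a leaf labeled with a class if all objects of $G$ are in that class; otherwise its root is labeled with a test $t$ and its children are decision trees for the nonempty sets $G^i_t$. For an object $s$, $cost(D,s)$ is the sum of $c^{t(s)}(t)$ over the tests $t$ on the root-to-leaf path of $s$ in $D$; $cost_W(D)=\max_s cost(D,s)$, and $OPT_W(S)$ is the minimum of $cost_W(D)$ over decision trees $D$ for $S$. $P(G)$ is the number of pairs of objects of $G$ lying in different classes. Algorithm \textsc{DividePairs} on a set $G$: if all objects of $G$ are in the same class, return a leaf; otherwise choose a test $t$ minimizing $\max_{1\le i\le\ell} c^i(t)/(P(G)-P(G^i_t))$ (ratio with zero denominator taken as $+\infty$), make it the root, and recursively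 build the subtrees for each nonempty $G^i_t$. -}

module Defs where

open import Data.Bool.Base using (if_then_else_)
open import Data.Nat.Base as ℕ using (ℕ; zero; suc; _∸_; _≤ᵇ_)
open import Data.Nat.Logarithm using (⌊log₂_⌋)
open import Data.Integer.Base as ℤ using (+_; ∣_∣)
open import Data.Rational.Base as ℚ using (ℚ; 0ℚ; 1ℚ; _/_; ↥_; ↧ₙ_)
open import Data.Fin.Base using (Fin; toℕ) renaming (_<_ to _<ᶠ_)
import Data.Fin.Properties as Fin
open import Data.Fin.Subset using (Subset; _∈_; _∩_; ⊤; Nonempty; Empty)
open import Data.Fin.Subset.Properties using (_∈?_)
open import Data.Vec.Base as Vec using (Vec; []; _∷_)
open import Data.List.Base using (List; []; _∷_; map; foldr; filter; length; allFin; tabulate; cartesianProduct)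
open import Data.Product.Base using (_×_; _,_; ∃; ∃-syntax; Σ-syntax)
open import Relation.Nullary.Negation.Core using (¬_)
open import Relation.Nullary.Decidable using (Dec; does; _×-dec_; ¬?)
open import Relation.Nullary.Construct.Add.Supremum using (_⁺; ⊤⁺; [_])
open import Relation.Binary.Construct.Add.Supremum.NonStrict ℚ._≤_ using (_≤⁺_)
open import Relation.Binary.PropositionalEquality.Core using (_≡_; _≢_)

------------------------------------------------------------------------
-- The value-dependent DFEP

sumℚ maxℚ : List ℚ → ℚ
sumℚ = foldr ℚ._+_ 0ℚ
-- Only applied to lists of nonnegative numbers.
maxℚ = foldr ℚ._⊔_ 0ℚ

-- Objects, classes and tests are Fin n, Fin m and Fin k.
record Instance (ℓ : ℕ) : Set where
  field
    n m k    : ℕ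
    class    : Fin n → Fin m
    prob     : Fin n → ℚ
    outcome  : Fin k → Fin n → Fin ℓ
    testCost : Fin k → Fin ℓ → ℚ

    class-nonempty    : ∀ j → ∃[ s ] class s ≡ j
    prob-nonneg       : ∀ s → 0ℚ ℚ.≤ prob s
    prob-total        : sumℚ (tabulate prob) ≡ 1ℚ
    testCost-positive : ∀ t i → 0ℚ ℚ.< testCost t i
    complete          : ∀ s s′ → s ≢ s′ → ∃[ t ] outcome t s ≢ outcome t s′

module _ {ℓ : ℕ} (I : Instance ℓ) where
  open Instance I

  Homogeneous : Subset n → Set
  Homogeneous G = ∃[ j ] (∀ {s} → s ∈ G → class s ≡ j)

  -- G^i_t
  branch : Subset n → Fin k → Fin ℓ → Subset n
  branch G t i = G ∩ Vec.tabulate (λ s → does (outcome t s Fin.≟ i))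

  mutual
    data DecTree (G : Subset n) : Set where
      leaf : (j : Fin m) → (∀ {s} → s ∈ G → class s ≡ j) → DecTree G
      node : ¬ Homogeneous G → (t : Fin k) →
             ((i : Fin ℓ) → Child (branch G t i)) → DecTree G

    data Child (G : Subset n) : Set where
      absent  : Empty G → Child G
      present : Nonempty G → DecTree G → Child G

  -- For D : DecTree G, meaningful for s ∈ G only; such an s never reaches
  -- an absent child.
  mutual
    cost : ∀ {G} → DecTree G → Fin n → ℚ
    cost (leaf _ _)    s = 0ℚ
    cost (node _ t ch) s =
      testCost t (outcome t s) ℚ.+ childCost (ch (outcome t s)) s

    childCost : ∀ {G} → Child G → Fin n → ℚ
    childCost (absent _)    s = 0ℚ
    childCost (present _ D) s = cost D s

  costW : ∀ {G} → DecTree G → ℚ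
  costW {G} D = maxℚ (map (cost D) (filter (_∈? G) (allFin n)))

  IsOPTW : Subset n → ℚ → Set
  IsOPTW G v =
    (Σ[ D ∈ DecTree G ] costW D ≡ v) × ((D : DecTree G) → v ℚ.≤ costW D)

  -- An unordered pair is represented by its increasing enumeration.
  SeparatedPair : Subset n → Fin n × Fin n → Set
  SeparatedPair G (s , s′) = s <ᶠ s′ × s ∈ G × s′ ∈ G × class s ≢ class s′

  separatedPair? : ∀ G p → Dec (SeparatedPair G p)
  separatedPair? G (s , s′) =
    (s Fin.<? s′) ×-dec (s ∈? G) ×-dec (s′ ∈? G) ×-dec ¬? (class s Fin.≟ class s′)

  P : Subset n → ℕ
  P G = length (filter (separatedPair? G) (cartesianProduct (allFin n) (allFin n)))

  -- DividePairs, with values in ℚ ⁺ = ℚ ∪ {+∞}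

  divide : ℚ → ℕ → ℚ ⁺
  divide c zero    = ⊤⁺
  divide c (suc d) = [ c ℚ.* (+ 1 / suc d) ]

  _⊔⁺_ : ℚ ⁺ → ℚ ⁺ → ℚ ⁺
  [ p ] ⊔⁺ [ q ] = [ p ℚ.⊔ q ]
  _     ⊔⁺ _     = ⊤⁺

  -- The truncated subtraction is exact because branch G t i ⊆ G.
  ratio : Subset n → Fin k → Fin ℓ → ℚ ⁺
  ratio G t i = divide (testCost t i) (P G ∸ P (branch G t i))

  maxRatio : Subset n → Fin k → ℚ ⁺
  maxRatio G t = foldr _⊔⁺_ [ 0ℚ ] (tabulate (ratio G t))

  -- D is a possible output of the algorithm, for some way of breaking ties.
  mutual
    data DividePairs : ∀ {G} → DecTree G → Set where
      leaf : ∀ {G j} {h : ∀ {s} → s ∈ G → class s ≡ j} → DividePairs (leaf {G} j h)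
      node : ∀ {G h t ch} →
             (∀ t′ → maxRatio G t ≤⁺ maxRatio G t′) →
             (∀ i → DividePairsChild (ch i)) →
             DividePairs (node {G} h t ch)

    data DividePairsChild : ∀ {G} → Child G → Set where
      absent  : ∀ {G h} → DividePairsChild (absent {G} h)
      present : ∀ {G h D} → DividePairs D → DividePairsChild (present {G} h D)

------------------------------------------------------------------------
-- Harmonic numbers and logarithms

fromℕ : ℕ → ℚ
fromℕ k = + k / 1

H : ℕ → ℚ
H zero    = 0ℚ
H (suc k) = H k ℚ.+ (+ 1 / suc k)

expTerm : ℕ → ℚ → ℚ
expTerm zero    x = 1ℚ
expTerm (suc j) x = expTerm j x ℚ.* x ℚ.* (+ 1 / suc j)

-- expSum N x = ∑_{j ≤ N} x ^ j / j!
expSum : ℕ → ℚ → ℚ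
expSum zero    x = expTerm zero x
expSum (suc N) x = expSum N x ℚ.+ expTerm (suc N) x

infix 4 ln_<_ _≤_·ln_

-- For k ≥ 1 this says  ln k < u : the partial sums increase to exp u when
-- u ≥ 0, and ln k ≥ 0.
ln_<_ : ℕ → ℚ → Set
ln k < u = 0ℚ ℚ.≤ u × ∃[ N ] fromℕ k ℚ.< expSum N u

-- The real inequality  x ≤ r · ln k  for k ≥ 1 and r ≥ 0, the real number
-- ln k being the infimum of its rational strict upper bounds.
_≤_·ln_ : ℚ → ℚ → ℕ → Set
x ≤ r ·ln k = ∀ u → ln k < u → x ℚ.≤ r ℚ.* u

------------------------------------------------------------------------
-- Polynomial time
--
-- Programs are finite families of mutually recursive first-order functions
-- over binary trees whose leaves are natural numbers written in binary.
-- Every evaluation step has unit cost, and an arithmetic operation also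
-- costs the total length of its operands (the logarithmic cost criterion).
-- With values held as pointers to shared cells, and with the output charged
-- for being written out in full, this is polynomially equivalent to Turing
-- machine time.

data Value : Set where
  nat  : ℕ → Value
  pair : Value → Value → Value

bitLength : ℕ → ℕ
bitLength x = suc ⌊log₂ x ⌋

size : Value → ℕ
size (nat x)    = bitLength x
size (pair v w) = suc (size v ℕ.+ size w)

data Op : Set where
  add sub mul leq : Op

⟦_⟧ : Op → ℕ → ℕ → ℕ
⟦ add ⟧ x y = x ℕ.+ y
⟦ sub ⟧ x y = x ∸ y
⟦ mul ⟧ x y = x ℕ.* y
⟦ leq ⟧ x y = if x ≤ᵇ y then 1 else 0

-- Variables are de Bruijn indices, the innermost binder being zero.
data Expr {f : ℕ} (arity : Fin f → ℕ) (Γ : ℕ) : Set where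
  var  : Fin Γ → Expr arity Γ
  lit  : ℕ → Expr arity Γ
  op   : Op → Expr arity Γ → Expr arity Γ → Expr arity Γ
  pair : Expr arity Γ → Expr arity Γ → Expr arity Γ
  let′ : Expr arity Γ → Expr arity (suc Γ) → Expr arity Γ
  -- if the scrutinee is the number 0; if it is a positive number
  ifz  : Expr arity Γ → Expr arity Γ → Expr arity Γ → Expr arity Γ
  -- if the scrutinee is a number (bound by 0); if it is a pair (first
  -- component bound by 0, second by 1)
  case : Expr arity Γ → Expr arity (suc Γ) → Expr arity (suc (suc Γ)) → Expr arity Γ
  call : (g : Fin f) → Vec (Expr arity Γ) (arity g) → Expr arity Γ

record Program : Set where
  field
    {functions} : ℕ
    arity       : Fin functions → ℕ
    body        : (g : Fin functions) → Expr arity (arity g)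
    main        : Expr arity 1

-- ρ ⊢ e ⇓ v [ c ] : in the environment ρ, e evaluates to v at cost c.
module _ (A : Program) where
  open Program A

  infix 4 _⊢_⇓_[_] _⊢*_⇓_[_]

  mutual
    data _⊢_⇓_[_] {Γ : ℕ} (ρ : Vec Value Γ) : Expr arity Γ → Value → ℕ → Set where
      var : ∀ {x} → ρ ⊢ var x ⇓ Vec.lookup ρ x [ 1 ]
      lit : ∀ {x} → ρ ⊢ lit x ⇓ nat x [ 1 ]
      op : ∀ {o e₁ e₂ x y c₁ c₂} →
           ρ ⊢ e₁ ⇓ nat x [ c₁ ] → ρ ⊢ e₂ ⇓ nat y [ c₂ ] →
           ρ ⊢ op o e₁ e₂ ⇓ nat (⟦ o ⟧ x y)
             [ suc (c₁ ℕ.+ c₂ ℕ.+ (bitLength x ℕ.+ bitLength y)) ]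
      pair : ∀ {e₁ e₂ v w c₁ c₂} →
             ρ ⊢ e₁ ⇓ v [ c₁ ] → ρ ⊢ e₂ ⇓ w [ c₂ ] →
             ρ ⊢ pair e₁ e₂ ⇓ pair v w [ suc (c₁ ℕ.+ c₂) ]
      let′ : ∀ {e₁ e₂ v w c₁ c₂} →
             ρ ⊢ e₁ ⇓ v [ c₁ ] → (v ∷ ρ) ⊢ e₂ ⇓ w [ c₂ ] →
             ρ ⊢ let′ e₁ e₂ ⇓ w [ suc (c₁ ℕ.+ c₂) ]
      ifz-zero : ∀ {e e₁ e₂ v c c₁} →
                 ρ ⊢ e ⇓ nat 0 [ c ] → ρ ⊢ e₁ ⇓ v [ c₁ ] →
                 ρ ⊢ ifz e e₁ e₂ ⇓ v [ suc (c ℕ.+ c₁) ]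
      ifz-suc : ∀ {e e₁ e₂ x v c c₂} →
                ρ ⊢ e ⇓ nat (suc x) [ c ] → ρ ⊢ e₂ ⇓ v [ c₂ ] →
                ρ ⊢ ifz e e₁ e₂ ⇓ v [ suc (c ℕ.+ c₂) ]
      case-nat : ∀ {e e₁ e₂ x v c c₁} →
                 ρ ⊢ e ⇓ nat x [ c ] → (nat x ∷ ρ) ⊢ e₁ ⇓ v [ c₁ ] →
                 ρ ⊢ case e e₁ e₂ ⇓ v [ suc (c ℕ.+ c₁) ]
      case-pair : ∀ {e e₁ e₂ w₁ w₂ v c c₂} →
                  ρ ⊢ e ⇓ pair w₁ w₂ [ c ] → (w₁ ∷ w₂ ∷ ρ) ⊢ e₂ ⇓ v [ c₂ ] →
                  ρ ⊢ case e e₁ e₂ ⇓ v [ suc (c ℕ.+ c₂) ]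
      call : ∀ {g es vs v c c′} →
             ρ ⊢* es ⇓ vs [ c ] → vs ⊢ body g ⇓ v [ c′ ] →
             ρ ⊢ call g es ⇓ v [ suc (c ℕ.+ c′) ]

    data _⊢*_⇓_[_] {Γ : ℕ} (ρ : Vec Value Γ) :
                   ∀ {a} → Vec (Expr arity Γ) a → Vec Value a → ℕ → Set where
      []  : ρ ⊢* [] ⇓ [] [ 0 ]
      _∷_ : ∀ {a e v c c′} {es : Vec (Expr arity Γ) a} {vs} →
            ρ ⊢ e ⇓ v [ c ] → ρ ⊢* es ⇓ vs [ c′ ] →
            ρ ⊢* (e ∷ es) ⇓ (v ∷ vs) [ c ℕ.+ c′ ]

  OutputsWithin : ℕ → Value → Value → Set
  OutputsWithin b x y = ∃[ c ] (x ∷ []) ⊢ main ⇓ y [ c ] × c ℕ.+ size y ℕ.≤ b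

------------------------------------------------------------------------
-- Encodings of instances and decision trees

encList : List Value → Value
encList []       = nat 0
encList (v ∷ vs) = pair v (encList vs)

encFin : ∀ {a} → Fin a → Value
encFin i = nat (toℕ i)

-- The sign is dropped: all rationals of an instance are nonnegative.
encℚ : ℚ → Value
encℚ q = pair (nat ∣ ↥ q ∣) (nat (↧ₙ q))

module _ {ℓ : ℕ} (I : Instance ℓ) where
  open Instance I

  encTest : Fin k → Value
  encTest t = pair (encList (tabulate (λ s → encFin (outcome t s))))
                   (encList (tabulate (λ i → encℚ (testCost t i))))

  encInstance : Value
  encInstance = pair (encList (tabulate (λ s → encFin (class s))))
               (pair (encList (tabulate (λ s → encℚ (prob s))))
                     (encList (tabulate encTest)))

  mutual
    encTree : ∀ {G} → DecTree I G → Value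
    encTree (leaf j _)    = encFin j
    encTree (node _ t ch) = pair (encFin t) (encList (tabulate (λ i → encChild (ch i))))

    -- An absent child is the empty list, a present one a singleton list.
    encChild : ∀ {G} → Child I G → Value
    encChild (absent _)    = encList []
    encChild (present _ D) = encList (encTree D ∷ [])

module Submission where

-- Let D* be any decision tree for S and let ρ be the minimum over the tests t
-- of max_i c^i(t) / (P(G) - P(G^i_t)). Every test then has a branch on which it
-- pays at least ρ for each pair of G that it separates; following these
-- branches in D* leads to a homogeneous set, so that ρ P(G) ≤ cost_W(D*).
-- Hence a test of the greedy tree that reduces P from a to b costs at most
-- cost_W(D*) (a - b) / a ≤ cost_W(D*) (H(a) - H(b)), and a path telescopes to
-- H(P(S)) cost_W(D*). As 1 / k ≤ ln ((2k + 1) / (2k - 1)), we have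
-- H(k) ≤ ln (2k + 1), and 2 P(S) + 1 ≤ n². The algorithm is polynomial because
-- the minimal ratio is finite on a set that is not homogeneous, so that every
-- chosen test splits its set and the greedy tree has fewer than 2 n nodes.

open import Defs
open import Data.Nat.Base as ℕ using (ℕ)
open import Data.Rational.Base as ℚ using (ℚ)
open import Data.Fin.Subset using (⊤)
open import Data.Fin.Subset.Properties using (∣p∣≤n)
open import Data.Product.Base using (_×_; _,_; ∃-syntax; Σ-syntax)
open import Relation.Binary.PropositionalEquality.Core using (refl)

-- The logarithm of the statement is given only by partial sums of the exponential series, so the
-- law exp (x + y) = exp x exp y is not at hand. Partial sums of equal length are submultiplicative
-- at nonnegative arguments, and this direction suffices because exp (H k / 2) has to be bounded
-- from above, for all truncations alike. The half comes from 2 ln n = ln (n²): squares are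
-- compared, and no logarithm of a product is formed. That tests are binary matters when a branch is
-- empty: the other branch is then the whole set. This lets the adversary of the lower bound
-- continue without loss. It also settles the existence of the optimum: a tree may apply tests that
-- do not split its set, even repeatedly, so a set can have infinitely many trees, and the minimum
-- has to be reduced to splitting tests. The program neither divides nor reduces fractions. Every
-- ratio is formed afresh from a cost and a number of pairs and compared by cross-multiplication,
-- which keeps all numbers short.

-- Natural numbers and their reciprocals in the ordered field of rationals

module Rationals where
  open import Data.Nat.Base as ℕ using (ℕ; suc; z≤n)
  import Data.Nat.Properties as ℕ
  open import Data.Integer.Base as ℤ using (+_)
  import Data.Integer.Properties as ℤ
  open import Data.Rational.Base
  open import Data.Rational.Properties
  open import Data.Rational.Unnormalised.Base as ℚᵘ using (mkℚᵘ; *≡*; *≤*)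
  import Data.Rational.Unnormalised.Properties as ℚᵘ
  open import Relation.Binary.PropositionalEquality hiding ([_])

  -- `_/_` reduces by a gcd, which is stuck on variables. Unnormalised rationals avoid it, and there
  -- the claim is an identity of integers.
  fromℕ-+ : ∀ a b → fromℕ (a ℕ.+ b) ≡ fromℕ a + fromℕ b
  fromℕ-+ a b = toℚᵘ-injective
    (ℚᵘ.≃-trans (toℚᵘ-fromℚᵘ (mkℚᵘ (+ (a ℕ.+ b)) 0))
    (ℚᵘ.≃-trans (*≡* eq)
    (ℚᵘ.≃-sym (ℚᵘ.≃-trans (toℚᵘ-homo-+ (fromℕ a) (fromℕ b))
      (ℚᵘ.+-cong (toℚᵘ-fromℚᵘ (mkℚᵘ (+ a) 0)) (toℚᵘ-fromℚᵘ (mkℚᵘ (+ b) 0)))))))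
    where
    eq : + (a ℕ.+ b) ℤ.* + 1 ≡ (+ a ℤ.* + 1 ℤ.+ + b ℤ.* + 1) ℤ.* + 1
    eq = cong (ℤ._* + 1) (sym (cong₂ ℤ._+_ (ℤ.*-identityʳ (+ a)) (ℤ.*-identityʳ (+ b))))

  fromℕ-* : ∀ a b → fromℕ (a ℕ.* b) ≡ fromℕ a * fromℕ b
  fromℕ-* a b = toℚᵘ-injective
    (ℚᵘ.≃-trans (toℚᵘ-fromℚᵘ (mkℚᵘ (+ (a ℕ.* b)) 0))
    (ℚᵘ.≃-trans (*≡* (cong (ℤ._* + 1) (ℤ.pos-* a b)))
    (ℚᵘ.≃-sym (ℚᵘ.≃-trans (toℚᵘ-homo-* (fromℕ a) (fromℕ b))
      (ℚᵘ.*-cong (toℚᵘ-fromℚᵘ (mkℚᵘ (+ a) 0)) (toℚᵘ-fromℚᵘ (mkℚᵘ (+ b) 0)))))))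

  fromℕ-mono : ∀ {a b} → a ℕ.≤ b → fromℕ a ≤ fromℕ b
  fromℕ-mono {a} {b} a≤b = toℚᵘ-cancel-≤
    (ℚᵘ.≤-respˡ-≃ (ℚᵘ.≃-sym (toℚᵘ-fromℚᵘ (mkℚᵘ (+ a) 0)))
    (ℚᵘ.≤-respʳ-≃ (ℚᵘ.≃-sym (toℚᵘ-fromℚᵘ (mkℚᵘ (+ b) 0)))
      (*≤* (ℤ.*-monoʳ-≤-nonNeg (+ 1) (ℤ.+≤+ a≤b)))))

  0≤fromℕ : ∀ a → 0ℚ ≤ fromℕ a
  0≤fromℕ a = fromℕ-mono {0} {a} z≤n

  recip : ℕ → ℚ
  recip d = + 1 / suc d

  recip-inverse : ∀ d → recip d * fromℕ (suc d) ≡ 1ℚ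
  recip-inverse d = toℚᵘ-injective
    (ℚᵘ.≃-trans (toℚᵘ-homo-* (recip d) (fromℕ (suc d)))
    (ℚᵘ.≃-trans (ℚᵘ.*-cong (toℚᵘ-fromℚᵘ (mkℚᵘ (+ 1) d)) (toℚᵘ-fromℚᵘ (mkℚᵘ (+ suc d) 0)))
      (*≡* (trans (ℤ.*-identityʳ _) 
        (sym (trans (ℤ.*-identityˡ _) (trans (cong +_ (ℕ.*-identityʳ (suc d))) (sym (ℤ.*-identityˡ (+ suc d))))))))))

  0≤recip : ∀ d → 0ℚ ≤ recip d
  0≤recip d = nonNegative⁻¹ _ {{normalize-nonNeg 1 (suc d)}}

  0≤+ : ∀ {p q} → 0ℚ ≤ p → 0ℚ ≤ q → 0ℚ ≤ p + q
  0≤+ {p} {q} 0≤p 0≤q = nonNegative⁻¹ _ {{nonNeg+nonNeg⇒nonNeg p {{nonNegative 0≤p}} q {{nonNegative 0≤q}}}}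

  0≤* : ∀ {p q} → 0ℚ ≤ p → 0ℚ ≤ q → 0ℚ ≤ p * q
  0≤* {p} {q} 0≤p 0≤q = nonNegative⁻¹ _ {{nonNeg*nonNeg⇒nonNeg p {{nonNegative 0≤p}} q {{nonNegative 0≤q}}}}

  *-mono-≤ : ∀ {p q r s} → 0ℚ ≤ p → 0ℚ ≤ s → p ≤ q → r ≤ s → p * r ≤ q * s
  *-mono-≤ {p} {q} {r} {s} 0≤p 0≤s p≤q r≤s =
    ≤-trans (*-monoˡ-≤-nonNeg p {{nonNegative 0≤p}} r≤s) (*-monoʳ-≤-nonNeg s {{nonNegative 0≤s}} p≤q)

  *-monoʳ : ∀ {p q r} → 0ℚ ≤ r → p ≤ q → p * r ≤ q * r
  *-monoʳ {r = r} 0≤r = *-monoʳ-≤-nonNeg r {{nonNegative 0≤r}}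

  *-monoˡ : ∀ {p q r} → 0ℚ ≤ r → p ≤ q → r * p ≤ r * q
  *-monoˡ {r = r} 0≤r = *-monoˡ-≤-nonNeg r {{nonNegative 0≤r}}

  p≤p+q : ∀ {p q} → 0ℚ ≤ q → p ≤ p + q
  p≤p+q {p} {q} 0≤q = subst (_≤ p + q) (+-identityʳ p) (+-monoʳ-≤ p 0≤q)

  q≤p+q : ∀ {p q} → 0ℚ ≤ p → q ≤ p + q
  q≤p+q {p} {q} 0≤p = subst (_≤ p + q) (+-identityˡ q) (+-monoˡ-≤ q 0≤p)

  0<fromℕ-suc : ∀ d → 0ℚ < fromℕ (suc d)
  0<fromℕ-suc d = positive⁻¹ _ {{normalize-pos (suc d) 1}}

  cancelʳ-fromℕ-suc : ∀ {p q} d → p * fromℕ (suc d) ≤ q * fromℕ (suc d) → p ≤ q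
  cancelʳ-fromℕ-suc d = *-cancelʳ-≤-pos (fromℕ (suc d)) {{positive (0<fromℕ-suc d)}}

  0≤q-p : ∀ {p q} → p ≤ q → 0ℚ ≤ q - p
  0≤q-p {p} {q} p≤q = subst (_≤ q - p) (+-inverseʳ p) (+-monoˡ-≤ (- p) p≤q)

-- Truncated exponential series and harmonic numbers

module Logarithm where
  open Rationals
  open import Data.Nat.Base as ℕ using (ℕ; zero; suc; z≤n; s≤s)
  import Data.Nat.Properties as ℕ
  open import Data.Rational.Base
  open import Data.Rational.Properties
  open import Data.Rational.Solver using (module +-*-Solver)
  open import Data.Product.Base using (_,_)
  open import Relation.Nullary using (yes; no; contradiction)
  open import Relation.Binary.PropositionalEquality hiding ([_])
  open +-*-Solver using (_:=_; _:+_; _:*_; _:-_; con) renaming (solve to solveℚ)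

  0≤1 : 0ℚ ≤ 1ℚ
  0≤1 = 0≤fromℕ 1

  0≤expTerm : ∀ j {x} → 0ℚ ≤ x → 0ℚ ≤ expTerm j x
  0≤expTerm zero    0≤x = 0≤1
  0≤expTerm (suc j) 0≤x = 0≤* (0≤* (0≤expTerm j 0≤x) 0≤x) (0≤recip j)

  0≤expSum : ∀ N {x} → 0ℚ ≤ x → 0ℚ ≤ expSum N x
  0≤expSum zero    0≤x = 0≤expTerm 0 0≤x
  0≤expSum (suc N) 0≤x = 0≤+ (0≤expSum N 0≤x) (0≤expTerm (suc N) 0≤x)

  expTerm-mono : ∀ j {x y} → 0ℚ ≤ x → x ≤ y → expTerm j x ≤ expTerm j y
  expTerm-mono zero    0≤x x≤y = ≤-refl
  expTerm-mono (suc j) 0≤x x≤y =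
    *-monoʳ (0≤recip j) (*-mono-≤ (0≤expTerm j 0≤x) (≤-trans 0≤x x≤y) (expTerm-mono j 0≤x x≤y) x≤y)

  expSum-mono : ∀ N {x y} → 0ℚ ≤ x → x ≤ y → expSum N x ≤ expSum N y
  expSum-mono zero    0≤x x≤y = ≤-refl
  expSum-mono (suc N) 0≤x x≤y = +-mono-≤ (expSum-mono N 0≤x x≤y) (expTerm-mono (suc N) 0≤x x≤y)

  expSum-zero : ∀ N → expSum N 0ℚ ≡ 1ℚ
  expSum-zero zero    = refl
  expSum-zero (suc N) = trans
    (solveℚ 3 (λ s t r → s :+ t :* con 0ℚ :* r := s) refl (expSum N 0ℚ) (expTerm N 0ℚ) (recip N))
    (expSum-zero N)

  -- The recursion of x ^ j / j! freed of its division; with it the addition theorem below does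
  -- without binomial coefficients.
  suc*expTerm : ∀ j x → fromℕ (suc j) * expTerm (suc j) x ≡ x * expTerm j x
  suc*expTerm j x = trans
    (solveℚ 4 (λ n e x r → n :* (e :* x :* r) := (r :* n) :* (x :* e)) refl
      (fromℕ (suc j)) (expTerm j x) x (recip j))
    (trans (cong (_* (x * expTerm j x)) (recip-inverse j)) (*-identityˡ _))

  fromℕ-suc : ∀ k → fromℕ (suc k) ≡ 1ℚ + fromℕ k
  fromℕ-suc k = fromℕ-+ 1 k

  module Cauchy (x y : ℚ) where
    -- convolution j k = ∑_{i ≤ j} x ^ i / i! · y ^ (j - i + k) / (j - i + k)!
    convolution : ℕ → ℕ → ℚ
    convolution zero    k = expTerm k y
    convolution (suc j) k = expTerm (suc j) x * expTerm k y + convolution j (suc k)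

    -- The product of x ^ i / i! and y ^ l / l! is multiplied by its total degree `i + l`: the share
    -- `i` lowers the first exponent and releases a factor `x`, the share `l` lowers the second and
    -- releases a factor `y`. Only for `i = j + 1`, where `l = k`, does lowering `l` lead outside
    -- `convolution j k`; this term is the correction.
    convolution-rec : ∀ j k → fromℕ (suc j ℕ.+ k) * convolution (suc j) k
      ≡ (x + y) * convolution j k + fromℕ k * (expTerm (suc j) x * expTerm k y)
    convolution-rec zero k = begin
      fromℕ (1 ℕ.+ k) * (expTerm 1 x * expTerm k y + expTerm (suc k) y)
        ≡⟨ *-distribˡ-+ (fromℕ (suc k)) _ _ ⟩
      fromℕ (1 ℕ.+ k) * (expTerm 1 x * expTerm k y) + fromℕ (suc k) * expTerm (suc k) y
        ≡⟨ cong₂ _+_ (cong (_* (expTerm 1 x * expTerm k y)) (fromℕ-suc k)) (suc*expTerm k y) ⟩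
      (1ℚ + fromℕ k) * (expTerm 1 x * expTerm k y) + y * expTerm k y
        ≡⟨ solveℚ 5 (λ n t e x y → (con 1ℚ :+ n) :* (t :* e) :+ y :* e :=
             (con 1ℚ :* t :+ y) :* e :+ n :* (t :* e)) refl
             (fromℕ k) (expTerm 1 x) (expTerm k y) x y ⟩
      (1ℚ * expTerm 1 x + y) * expTerm k y + fromℕ k * (expTerm 1 x * expTerm k y)
        ≡⟨ cong (λ z → (z + y) * expTerm k y + fromℕ k * (expTerm 1 x * expTerm k y))
             (trans (suc*expTerm 0 x) (*-identityʳ x)) ⟩
      (x + y) * expTerm k y + fromℕ k * (expTerm 1 x * expTerm k y) ∎
      where open ≡-Reasoning
    convolution-rec (suc j) k = begin
      N * (a * b + c)
        ≡⟨ *-distribˡ-+ N (a * b) c ⟩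
      N * (a * b) + N * c
        ≡⟨ cong₂ _+_ (cong (_* (a * b)) (fromℕ-+ (suc (suc j)) k))
             (trans (cong (λ i → fromℕ (suc i) * c) (sym (ℕ.+-suc j k))) (convolution-rec j (suc k))) ⟩
      (fromℕ (suc (suc j)) + fromℕ k) * (a * b)
        + ((x + y) * convolution j (suc k) + fromℕ (suc k) * (expTerm (suc j) x * expTerm (suc k) y))
        ≡⟨ solveℚ 9 (λ m k a b x y d l t → (m :+ k) :* (a :* b) :+ ((x :+ y) :* d :+ l) :=
             (m :* a) :* b :+ (x :+ y) :* d :+ k :* (a :* b) :+ l) refl
             (fromℕ (suc (suc j))) (fromℕ k) a b x y (convolution j (suc k))
             (fromℕ (suc k) * (expTerm (suc j) x * expTerm (suc k) y)) (expTerm (suc j) x) ⟩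
      (fromℕ (suc (suc j)) * a) * b + (x + y) * convolution j (suc k) + fromℕ k * (a * b)
        + fromℕ (suc k) * (expTerm (suc j) x * expTerm (suc k) y)
        ≡⟨ cong₂ (λ p q → p * b + (x + y) * convolution j (suc k) + fromℕ k * (a * b) + q)
             (suc*expTerm (suc j) x)
             (trans (solveℚ 3 (λ n s t → n :* (s :* t) := s :* (n :* t)) refl
                      (fromℕ (suc k)) (expTerm (suc j) x) (expTerm (suc k) y))
                    (cong (expTerm (suc j) x *_) (suc*expTerm k y))) ⟩
      (x * expTerm (suc j) x) * b + (x + y) * convolution j (suc k) + fromℕ k * (a * b)
        + expTerm (suc j) x * (y * b)
        ≡⟨ solveℚ 6 (λ x y b d s r → (x :* s) :* b :+ (x :+ y) :* d :+ r :+ s :* (y :* b) :=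
             (x :+ y) :* (s :* b :+ d) :+ r) refl
             x y b (convolution j (suc k)) (expTerm (suc j) x) (fromℕ k * (a * b)) ⟩
      (x + y) * (expTerm (suc j) x * b + convolution j (suc k)) + fromℕ k * (a * b) ∎
      where
      open ≡-Reasoning
      N = fromℕ (suc (suc j) ℕ.+ k)
      a = expTerm (suc (suc j)) x
      b = expTerm k y
      c = convolution (suc j) (suc k)

    -- The binomial theorem: for `k = 0` the correction in `convolution-rec` vanishes, and what is
    -- left is the recursion of `expTerm` at `x + y`.
    expTerm-+ : ∀ j → expTerm j (x + y) ≡ convolution j 0
    expTerm-+ zero    = refl
    expTerm-+ (suc j) = begin
      expTerm j (x + y) * (x + y) * recip j
        ≡⟨ cong (λ z → z * (x + y) * recip j) (expTerm-+ j) ⟩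
      convolution j 0 * (x + y) * recip j
        ≡⟨ solveℚ 4 (λ c z r t → c :* z :* r := (z :* c :+ con 0ℚ :* t) :* r) refl
             (convolution j 0) (x + y) (recip j) (expTerm (suc j) x * expTerm 0 y) ⟩
      ((x + y) * convolution j 0 + fromℕ 0 * (expTerm (suc j) x * expTerm 0 y)) * recip j
        ≡⟨ cong (_* recip j) (sym (convolution-rec j 0)) ⟩
      fromℕ (suc j ℕ.+ 0) * convolution (suc j) 0 * recip j
        ≡⟨ cong (λ i → fromℕ (suc i) * convolution (suc j) 0 * recip j) (ℕ.+-identityʳ j) ⟩
      fromℕ (suc j) * convolution (suc j) 0 * recip j
        ≡⟨ solveℚ 3 (λ n c r → n :* c :* r := (r :* n) :* c) refl
             (fromℕ (suc j)) (convolution (suc j) 0) (recip j) ⟩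
      recip j * fromℕ (suc j) * convolution (suc j) 0
        ≡⟨ cong (_* convolution (suc j) 0) (recip-inverse j) ⟩
      1ℚ * convolution (suc j) 0
        ≡⟨ *-identityˡ _ ⟩
      convolution (suc j) 0 ∎
      where open ≡-Reasoning

    convolutionSum : ℕ → ℕ → ℚ
    convolutionSum zero    k = convolution 0 k
    convolutionSum (suc N) k = convolutionSum N k + convolution (suc N) k

    expSum-+ : ∀ N → expSum N (x + y) ≡ convolutionSum N 0
    expSum-+ zero    = refl
    expSum-+ (suc N) = cong₂ _+_ (expSum-+ N) (expTerm-+ (suc N))

    -- `convolutionSum (suc N) k` runs over the triangle `i + l ≤ suc N` of products with exponents
    -- `i` of `x` and `l + k` of `y`. The row `l = 0` is cut off; the rest is the triangle of side
    -- `N` with `k` raised by one.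
    convolutionSum-suc : ∀ N k →
      convolutionSum (suc N) k ≡ expSum (suc N) x * expTerm k y + convolutionSum N (suc k)
    convolutionSum-suc zero k =
      solveℚ 3 (λ e t c → e :+ (t :* e :+ c) := (con 1ℚ :+ t) :* e :+ c) refl
        (expTerm k y) (expTerm 1 x) (expTerm (suc k) y)
    convolutionSum-suc (suc N) k = trans
      (cong (_+ convolution (suc (suc N)) k) (convolutionSum-suc N k))
      (solveℚ 5 (λ s e c t d → s :* e :+ c :+ (t :* e :+ d) := (s :+ t) :* e :+ (c :+ d)) refl
        (expSum (suc N) x) (expTerm k y) (convolutionSum N (suc k)) (expTerm (suc (suc N)) x)
        (convolution (suc N) (suc k)))

    -- Grows at its front, in step with the rows removed by `convolutionSum-suc`, whereas `expSum`
    -- grows at its end; `expSum-tail` identifies the two at `k = 0`.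
    expTail : ℕ → ℕ → ℚ
    expTail k zero    = expTerm k y
    expTail k (suc N) = expTerm k y + expTail (suc k) N

    expTail-snoc : ∀ k N → expTail k (suc N) ≡ expTail k N + expTerm (k ℕ.+ suc N) y
    expTail-snoc k zero    = cong (λ i → expTerm k y + expTerm i y) (sym (ℕ.+-comm k 1))
    expTail-snoc k (suc N) = trans
      (cong (expTerm k y +_) (expTail-snoc (suc k) N))
      (trans (sym (+-assoc (expTerm k y) (expTail (suc k) N) (expTerm (suc k ℕ.+ suc N) y)))
             (cong (λ i → expTerm k y + expTail (suc k) N + expTerm i y) (sym (ℕ.+-suc k (suc N)))))

    expSum-tail : ∀ N → expTail 0 N ≡ expSum N y
    expSum-tail zero    = refl
    expSum-tail (suc N) = trans (expTail-snoc 0 N) (cong (_+ expTerm (suc N) y) (expSum-tail N))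

    module _ (0≤x : 0ℚ ≤ x) (0≤y : 0ℚ ≤ y) where
      0≤expTail : ∀ k N → 0ℚ ≤ expTail k N
      0≤expTail k zero    = 0≤expTerm k 0≤y
      0≤expTail k (suc N) = 0≤+ (0≤expTerm k 0≤y) (0≤expTail (suc k) N)

      -- The triangle is contained in the square of side `N`, and the products outside it are
      -- nonnegative.
      convolutionSum-≤ : ∀ N k → convolutionSum N k ≤ expSum N x * expTail k N
      convolutionSum-≤ zero    k = ≤-reflexive (sym (*-identityˡ _))
      convolutionSum-≤ (suc N) k = begin
        convolutionSum (suc N) k
          ≡⟨ convolutionSum-suc N k ⟩
        expSum (suc N) x * expTerm k y + convolutionSum N (suc k)
          ≤⟨ +-monoʳ-≤ (expSum (suc N) x * expTerm k y) (convolutionSum-≤ N (suc k)) ⟩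
        expSum (suc N) x * expTerm k y + expSum N x * expTail (suc k) N
          ≤⟨ +-monoʳ-≤ (expSum (suc N) x * expTerm k y)
               (*-monoʳ (0≤expTail (suc k) N) (p≤p+q {expSum N x} (0≤expTerm (suc N) 0≤x))) ⟩
        expSum (suc N) x * expTerm k y + expSum (suc N) x * expTail (suc k) N
          ≡⟨ sym (*-distribˡ-+ (expSum (suc N) x) _ _) ⟩
        expSum (suc N) x * expTail k (suc N) ∎
        where open ≤-Reasoning

  expSum-submult : ∀ N {x y} → 0ℚ ≤ x → 0ℚ ≤ y → expSum N (x + y) ≤ expSum N x * expSum N y
  expSum-submult N {x} {y} 0≤x 0≤y = subst₂ _≤_ (sym (expSum-+ N)) (cong (expSum N x *_) (expSum-tail N))
    (convolutionSum-≤ 0≤x 0≤y N 0)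
    where open Cauchy x y

  recip-antimono : ∀ {a b} → a ℕ.≤ b → recip b ≤ recip a
  recip-antimono {a} {b} a≤b = cancelʳ-fromℕ-suc b (begin
    recip b * fromℕ (suc b)  ≡⟨ recip-inverse b ⟩
    1ℚ                       ≡⟨ sym (recip-inverse a) ⟩
    recip a * fromℕ (suc a)  ≤⟨ *-monoˡ (0≤recip a) (fromℕ-mono (s≤s a≤b)) ⟩
    recip a * fromℕ (suc b)  ∎)
    where open ≤-Reasoning

  2ℚ : ℚ
  2ℚ = fromℕ 2

  module _ {w : ℚ} (0≤w : 0ℚ ≤ w) where
    -- This is w (w / 2) ^ j, which majorises w ^ (j + 1) / (j + 1)! because every factor of the
    -- factorial beyond the first is at least 2.
    geometric : ℕ → ℚ
    geometric zero    = w
    geometric (suc j) = geometric j * w * ½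

    expTerm-geometric : ∀ j → expTerm (suc j) w ≤ geometric j
    expTerm-geometric zero    = ≤-reflexive (trans (*-identityʳ _) (*-identityˡ w))
    expTerm-geometric (suc j) =
      *-mono-≤ (0≤* (0≤expTerm (suc j) 0≤w) 0≤w) (0≤recip 1)
        (*-monoʳ 0≤w (expTerm-geometric j)) (recip-antimono (s≤s (z≤n {j})))

    -- The term `2ℚ * geometric N` is the remainder of the geometric series after the denominator
    -- `2ℚ - w` is cleared. Keeping it makes the induction an identity but for the comparison of one
    -- term.
    expSum-geometric : w ≤ 2ℚ → ∀ N → (2ℚ - w) * expSum N w + 2ℚ * geometric N ≤ 2ℚ + w
    expSum-geometric w≤2 zero = ≤-reflexive
      (solveℚ 1 (λ w → (con 2ℚ :- w) :* con 1ℚ :+ con 2ℚ :* w := con 2ℚ :+ w) refl w)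
    expSum-geometric w≤2 (suc N) = begin
      (2ℚ - w) * (expSum N w + expTerm (suc N) w) + 2ℚ * (geometric N * w * ½)
        ≤⟨ +-monoˡ-≤ _ (*-monoˡ (0≤q-p w≤2) (+-monoʳ-≤ (expSum N w) (expTerm-geometric N))) ⟩
      (2ℚ - w) * (expSum N w + geometric N) + 2ℚ * (geometric N * w * ½)
        ≡⟨ solveℚ 3 (λ w s g → (con 2ℚ :- w) :* (s :+ g) :+ con 2ℚ :* (g :* w :* con ½) :=
             (con 2ℚ :- w) :* s :+ con 2ℚ :* g) refl w (expSum N w) (geometric N) ⟩
      (2ℚ - w) * expSum N w + 2ℚ * geometric N
        ≤⟨ expSum-geometric w≤2 N ⟩
      2ℚ + w ∎
      where open ≤-Reasoning

    0≤geometric : ∀ N → 0ℚ ≤ geometric N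
    0≤geometric zero    = 0≤w
    0≤geometric (suc N) = 0≤* (0≤* (0≤geometric N) 0≤w) (0≤recip 1)

    -- exp w ≤ (2 + w) / (2 - w) by comparison with a geometric series, and
    -- its square is at most (1 + w) / (1 - w).
    expSum²-bound : w ≤ 1ℚ → ∀ N → expSum N w * expSum N w * (1ℚ - w) ≤ 1ℚ + w
    expSum²-bound w≤1 N = *-cancelˡ-≤-pos (a * a) {{positive 0<a²}} (begin
      a * a * (s * s * (1ℚ - w))
        ≡⟨ solveℚ 3 (λ a s w → a :* a :* (s :* s :* (con 1ℚ :- w)) := (a :* s) :* (a :* s) :* (con 1ℚ :- w))
             refl a s w ⟩
      (a * s) * (a * s) * (1ℚ - w)
        ≤⟨ *-monoʳ (0≤q-p w≤1) (*-mono-≤ 0≤as (≤-trans 0≤as as≤b) as≤b as≤b) ⟩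
      (2ℚ + w) * (2ℚ + w) * (1ℚ - w)
        ≤⟨ p≤p+q (0≤* (0≤fromℕ 2) (0≤* 0≤w (0≤* 0≤w 0≤w))) ⟩
      (2ℚ + w) * (2ℚ + w) * (1ℚ - w) + 2ℚ * (w * (w * w))
        ≡⟨ solveℚ 1 (λ w → (con 2ℚ :+ w) :* (con 2ℚ :+ w) :* (con 1ℚ :- w) :+ con 2ℚ :* (w :* (w :* w)) :=
             (con 2ℚ :- w) :* (con 2ℚ :- w) :* (con 1ℚ :+ w)) refl w ⟩
      a * a * (1ℚ + w) ∎)
      where
      open ≤-Reasoning
      a = 2ℚ - w
      s = expSum N w
      w≤2 : w ≤ 2ℚ
      w≤2 = ≤-trans w≤1 (fromℕ-mono {1} {2} (s≤s z≤n))
      0≤as : 0ℚ ≤ a * s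
      0≤as = 0≤* (0≤q-p w≤2) (0≤expSum N 0≤w)
      as≤b : a * s ≤ 2ℚ + w
      as≤b = ≤-trans (p≤p+q (0≤* (0≤fromℕ 2) (0≤geometric N))) (expSum-geometric w≤2 N)
      1≤a : 1ℚ ≤ a
      1≤a = subst (_≤ a) (solveℚ 1 (λ w → con 1ℚ :+ w :- w := con 1ℚ) refl w)
              (+-monoˡ-≤ (- w) (+-monoʳ-≤ 1ℚ w≤1))
      0<a² : 0ℚ < a * a
      0<a² = <-≤-trans (0<fromℕ-suc 0) (*-mono-≤ 0≤1 (≤-trans 0≤1 1≤a) 1≤a 1≤a)

  halfH : ℕ → ℚ
  halfH k = ½ * H k

  0≤H : ∀ k → 0ℚ ≤ H k
  0≤H zero    = ≤-refl
  0≤H (suc k) = 0≤+ (0≤H k) (0≤recip k)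


  0≤halfH : ∀ k → 0ℚ ≤ halfH k
  0≤halfH k = 0≤* (0≤recip 1) (0≤H k)

  -- exp (H k / 2) ² ≤ 2 k + 1: the increment 1 / (2 k + 2) of H k / 2 multiplies
  -- the left-hand side by at most (2 k + 3) / (2 k + 1).
  expSum-halfH : ∀ N k → expSum N (halfH k) * expSum N (halfH k) ≤ fromℕ (1 ℕ.+ 2 ℕ.* k)
  expSum-halfH N zero = ≤-reflexive (trans (cong (λ x → expSum N x * expSum N x) (*-zeroʳ ½))
    (cong (λ x → x * x) (expSum-zero N)))
  expSum-halfH N (suc k) = begin
    expSum N (½ * (H k + recip k)) * expSum N (½ * (H k + recip k))
      ≡⟨ cong (λ x → expSum N x * expSum N x) (*-distribˡ-+ ½ (H k) (recip k)) ⟩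
    expSum N (h + w) * expSum N (h + w)
      ≤⟨ *-mono-≤ 0≤Shw (≤-trans 0≤Shw Shw≤) Shw≤ Shw≤ ⟩
    expSum N h * s * (expSum N h * s)
      ≡⟨ solveℚ 2 (λ a b → a :* b :* (a :* b) := (a :* a) :* (b :* b)) refl (expSum N h) s ⟩
    expSum N h * expSum N h * (s * s)
      ≤⟨ *-monoʳ (0≤* 0≤s 0≤s) (expSum-halfH N k) ⟩
    fromℕ (1 ℕ.+ 2 ℕ.* k) * (s * s)
      ≡⟨ cong (_* (s * s)) odd ⟩
    2ℚ * fromℕ (suc k) * (1ℚ - w) * (s * s)
      ≡⟨ solveℚ 3 (λ a s w → a :* (con 1ℚ :- w) :* (s :* s) := a :* (s :* s :* (con 1ℚ :- w))) refl
           (2ℚ * fromℕ (suc k)) s w ⟩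
    2ℚ * fromℕ (suc k) * (s * s * (1ℚ - w))
      ≤⟨ *-monoˡ (0≤* (0≤fromℕ 2) (0≤fromℕ (suc k))) (expSum²-bound 0≤w w≤1 N) ⟩
    2ℚ * fromℕ (suc k) * (1ℚ + w)
      ≡⟨ even ⟩
    fromℕ (1 ℕ.+ 2 ℕ.* suc k) ∎
    where
    open ≤-Reasoning
    h = halfH k
    w = ½ * recip k
    s = expSum N w
    0≤w : 0ℚ ≤ w
    0≤w = 0≤* (0≤recip 1) (0≤recip k)
    w≤1 : w ≤ 1ℚ
    w≤1 = *-mono-≤ (0≤recip 1) 0≤1 (recip-antimono {0} {1} z≤n) (recip-antimono {0} {k} z≤n)
    0≤s : 0ℚ ≤ s
    0≤s = 0≤expSum N 0≤w
    0≤Shw : 0ℚ ≤ expSum N (h + w)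
    0≤Shw = 0≤expSum N (0≤+ (0≤halfH k) 0≤w)
    Shw≤ : expSum N (h + w) ≤ expSum N h * s
    Shw≤ = expSum-submult N (0≤halfH k) 0≤w
    odd : fromℕ (1 ℕ.+ 2 ℕ.* k) ≡ 2ℚ * fromℕ (suc k) * (1ℚ - w)
    odd = begin-equality
      fromℕ (1 ℕ.+ 2 ℕ.* k)
        ≡⟨ trans (fromℕ-+ 1 (2 ℕ.* k)) (cong (1ℚ +_) (fromℕ-* 2 k)) ⟩
      1ℚ + 2ℚ * fromℕ k
        ≡⟨ solveℚ 1 (λ n → con 1ℚ :+ con 2ℚ :* n := con 2ℚ :* (con 1ℚ :+ n) :- con 1ℚ) refl (fromℕ k) ⟩
      2ℚ * (1ℚ + fromℕ k) - 1ℚ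
        ≡⟨ cong₂ (λ a b → 2ℚ * a - b) (sym (fromℕ-suc k)) (sym (recip-inverse k)) ⟩
      2ℚ * fromℕ (suc k) - recip k * fromℕ (suc k)
        ≡⟨ solveℚ 2 (λ n r → con 2ℚ :* n :- r :* n := con 2ℚ :* n :* (con 1ℚ :- con ½ :* r)) refl
             (fromℕ (suc k)) (recip k) ⟩
      2ℚ * fromℕ (suc k) * (1ℚ - w) ∎
    even : 2ℚ * fromℕ (suc k) * (1ℚ + w) ≡ fromℕ (1 ℕ.+ 2 ℕ.* suc k)
    even = begin-equality
      2ℚ * fromℕ (suc k) * (1ℚ + w)
        ≡⟨ solveℚ 2 (λ n r → con 2ℚ :* n :* (con 1ℚ :+ con ½ :* r) := r :* n :+ con 2ℚ :* n) refl
             (fromℕ (suc k)) (recip k) ⟩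
      recip k * fromℕ (suc k) + 2ℚ * fromℕ (suc k)
        ≡⟨ cong (_+ 2ℚ * fromℕ (suc k)) (recip-inverse k) ⟩
      1ℚ + 2ℚ * fromℕ (suc k)
        ≡⟨ sym (trans (fromℕ-+ 1 (2 ℕ.* suc k)) (cong (1ℚ +_) (fromℕ-* 2 (suc k)))) ⟩
      fromℕ (1 ℕ.+ 2 ℕ.* suc k) ∎

  -- Suppose 2 u < H k. The truncation that exceeds `n` at `u` also exceeds it at the larger point
  -- `halfH k`, so its square exceeds n², whereas `expSum-halfH` bounds this square by 2 k + 1 ≤ n².
  H≤2ln : ∀ {n k} → 1 ℕ.+ 2 ℕ.* k ℕ.≤ n ℕ.* n → ∀ u → ln n < u → H k ≤ 2ℚ * u
  H≤2ln {n} {k} 2k+1≤n² u (0≤u , N , n<exp) with H k ≤? 2ℚ * u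
  ... | yes H≤2u = H≤2u
  ... | no  H≰2u = contradiction (begin-strict
    fromℕ n * fromℕ n                           ≤⟨ *-monoˡ (0≤fromℕ n) (<⇒≤ n<expH) ⟩
    fromℕ n * expSum N (halfH k)                <⟨ *-monoˡ-<-pos _ {{positive (≤-<-trans (0≤fromℕ n) n<expH)}} n<expH ⟩
    expSum N (halfH k) * expSum N (halfH k)     ≤⟨ expSum-halfH N k ⟩
    fromℕ (1 ℕ.+ 2 ℕ.* k)                       ≤⟨ fromℕ-mono 2k+1≤n² ⟩
    fromℕ (n ℕ.* n)                             ≡⟨ fromℕ-* n n ⟩
    fromℕ n * fromℕ n                           ∎) (<-irrefl refl)
    where
    open ≤-Reasoning
    u≤halfH : u ≤ halfH k
    u≤halfH = subst (_≤ halfH k)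
      (solveℚ 1 (λ u → con ½ :* (con 2ℚ :* u) := u) refl u)
      (*-monoˡ {r = ½} (0≤recip 1) (<⇒≤ (≰⇒> H≰2u)))
    n<expH : fromℕ n < expSum N (halfH k)
    n<expH = <-≤-trans n<exp (expSum-mono N 0≤u u≤halfH)

-- Counting the pairs of objects in different classes

module SeparatedPairs where
  open import Data.Bool.Base using (Bool; true; false; not; _∧_)
  open import Data.Nat.Base
  open import Data.Nat.Properties
  open import Data.Nat.Tactic.RingSolver using (solve-∀)
  open import Data.Fin.Base using (Fin; zero; suc)
  import Data.Fin.Properties as Fin
  open import Data.Fin.Subset using (Subset; _∈_; _⊆_; Nonempty; inside; outside)
  open import Data.Fin.Subset.Properties using (_∈?_; x∈p∩q⁺; x∈p∩q⁻)
  open import Data.Vec.Base using ([]; _∷_; here; there)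
  open import Data.Vec.Properties using (lookup∘tabulate; []=⇒lookup; lookup⇒[]=)
  open import Data.List.Base using
    (List; []; _∷_; _++_; map; filter; length; allFin; tabulate; cartesianProduct)
  open import Data.List.Properties using (filter-++; length-++; map-tabulate)
  open import Data.List.Membership.Propositional using () renaming (_∈_ to _∈ᴸ_)
  open import Data.List.Membership.Propositional.Properties using (∈-allFin; ∈-cartesianProduct⁺)
  open import Data.List.Relation.Unary.Any using (here; there)
  open import Data.Product.Base using (_×_; _,_; ∃-syntax; proj₁; proj₂)
  open import Function.Base using (_∘_; id)
  open import Level using (0ℓ)
  open import Relation.Nullary using (Dec; yes; no; does; contradiction; ¬_)
  open import Relation.Nullary.Decidable using (dec-true; dec-false)
  open import Relation.Unary using (Pred; Decidable)
  open import Relation.Binary.Definitions using (tri<; tri≈; tri>)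
  open import Relation.Binary.PropositionalEquality hiding ([_])
  open import Algebra.Properties.CommutativeMonoid.Sum +-0-commutativeMonoid using (sum; sum-replicate-zero)

  indicator : Bool → ℕ
  indicator true  = 1
  indicator false = 0

  indicator≤1 : ∀ b → indicator b ≤ 1
  indicator≤1 true  = ≤-refl
  indicator≤1 false = z≤n

  indicator-mono : ∀ {P Q : Set} (P? : Dec P) (Q? : Dec Q) → (P → Q) →
                   indicator (does P?) ≤ indicator (does Q?)
  indicator-mono (no _)  Q?       P⇒Q = z≤n
  indicator-mono (yes p) (yes _)  P⇒Q = ≤-refl
  indicator-mono (yes p) (no ¬q)  P⇒Q = contradiction (P⇒Q p) ¬q

  module _ {A : Set} where
    count : {P : Pred A 0ℓ} → Decidable P → List A → ℕ
    count P? xs = length (filter P? xs)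

    count-∷ : ∀ {P : Pred A 0ℓ} (P? : Decidable P) x xs →
              count P? (x ∷ xs) ≡ indicator (does (P? x)) + count P? xs
    count-∷ P? x xs with does (P? x)
    ... | true  = refl
    ... | false = refl

    count-++ : ∀ {P : Pred A 0ℓ} (P? : Decidable P) xs ys → count P? (xs ++ ys) ≡ count P? xs + count P? ys
    count-++ P? xs ys = trans (cong length (filter-++ P? xs ys)) (length-++ (filter P? xs))

    count-mono : ∀ {P Q : Pred A 0ℓ} (P? : Decidable P) (Q? : Decidable Q) →
                 (∀ {x} → P x → Q x) → ∀ xs → count P? xs ≤ count Q? xs
    count-mono P? Q? P⇒Q []       = z≤n
    count-mono P? Q? P⇒Q (x ∷ xs) rewrite count-∷ P? x xs | count-∷ Q? x xs =
      +-mono-≤ (indicator-mono (P? x) (Q? x) P⇒Q) (count-mono P? Q? P⇒Q xs)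

    count-mono-< : ∀ {P Q : Pred A 0ℓ} (P? : Decidable P) (Q? : Decidable Q) →
                   (∀ {x} → P x → Q x) → ∀ {y xs} → y ∈ᴸ xs → Q y → ¬ P y → count P? xs < count Q? xs
    count-mono-< P? Q? P⇒Q {xs = x ∷ xs} (here refl) Qy ¬Py
      rewrite count-∷ P? x xs | count-∷ Q? x xs | dec-true (Q? x) Qy | dec-false (P? x) ¬Py =
      s≤s (count-mono P? Q? P⇒Q xs)
    count-mono-< P? Q? P⇒Q {xs = x ∷ xs} (there y∈xs) Qy ¬Py
      rewrite count-∷ P? x xs | count-∷ Q? x xs =
      +-mono-≤-< (indicator-mono (P? x) (Q? x) P⇒Q) (count-mono-< P? Q? P⇒Q y∈xs Qy ¬Py)

    -- Elementwise: an element in one of `P` and `Q` is paid for by `R`, and an element in both is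
    -- paid for a second time by `S`.
    count-exchange : ∀ {P Q R S : Pred A 0ℓ}
      (P? : Decidable P) (Q? : Decidable Q) (R? : Decidable R) (S? : Decidable S) →
      (∀ {x} → P x → R x) → (∀ {x} → Q x → R x) → (∀ {x} → P x → Q x → S x) →
      ∀ xs → count P? xs + count Q? xs ≤ count R? xs + count S? xs
    count-exchange P? Q? R? S? P⇒R Q⇒R PQ⇒S []       = z≤n
    count-exchange P? Q? R? S? P⇒R Q⇒R PQ⇒S (x ∷ xs)
      rewrite count-∷ P? x xs | count-∷ Q? x xs | count-∷ R? x xs | count-∷ S? x xs =
      subst₂ _≤_ (interchange p q _ _) (interchange r s _ _)
        (+-mono-≤ head-≤ (count-exchange P? Q? R? S? P⇒R Q⇒R PQ⇒S xs))
      where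
      p = indicator (does (P? x))
      q = indicator (does (Q? x))
      r = indicator (does (R? x))
      s = indicator (does (S? x))
      interchange : ∀ a b c d → a + b + (c + d) ≡ a + c + (b + d)
      interchange = solve-∀
      head-≤ : p + q ≤ r + s
      head-≤ with P? x
      ... | no _   = ≤-trans (indicator-mono (Q? x) (R? x) Q⇒R) (m≤m+n r s)
      ... | yes Px = +-mono-≤ (indicator-mono (yes Px) (R? x) P⇒R) (indicator-mono (Q? x) (S? x) (PQ⇒S Px))

    count-none : ∀ {P : Pred A 0ℓ} (P? : Decidable P) → (∀ x → ¬ P x) → ∀ xs → count P? xs ≡ 0
    count-none P? ¬P []       = refl
    count-none P? ¬P (x ∷ xs) rewrite count-∷ P? x xs | dec-false (P? x) (¬P x) = count-none P? ¬P xs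

    count≡0⇒¬ : ∀ {P : Pred A 0ℓ} (P? : Decidable P) {xs} → count P? xs ≡ 0 → ∀ {x} → x ∈ᴸ xs → ¬ P x
    count≡0⇒¬ P? {y ∷ ys} eq (here refl) Px rewrite count-∷ P? y ys | dec-true (P? y) Px = contradiction eq λ ()
    count≡0⇒¬ P? {y ∷ ys} eq (there x∈ys) Px rewrite count-∷ P? y ys =
      count≡0⇒¬ P? (m+n≡0⇒n≡0 (indicator (does (P? y))) eq) x∈ys Px

    count-tabulate : ∀ {P : Pred A 0ℓ} (P? : Decidable P) {k} (f : Fin k → A) →
                     count P? (tabulate f) ≡ sum (λ i → indicator (does (P? (f i))))
    count-tabulate P? {zero}  f = refl
    count-tabulate P? {suc k} f = trans (count-∷ P? (f zero) _) 
      (cong (indicator (does (P? (f zero))) +_) (count-tabulate P? (f ∘ suc)))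

  count-cartesianProduct : ∀ {A B : Set} {P : Pred (A × B) 0ℓ} (P? : Decidable P)
    {k l} (f : Fin k → A) (g : Fin l → B) →
    count P? (cartesianProduct (tabulate f) (tabulate g)) ≡ sum (λ i → sum (λ j → indicator (does (P? (f i , g j)))))
  count-cartesianProduct P? {zero}  f g = refl
  count-cartesianProduct P? {suc k} f g = trans
    (count-++ P? (map (f zero ,_) (tabulate g)) (cartesianProduct (tabulate (f ∘ suc)) (tabulate g)))
    (cong₂ _+_
      (trans (cong (count P?) (map-tabulate g (f zero ,_))) (count-tabulate P? (λ j → f zero , g j)))
      (count-cartesianProduct P? (f ∘ suc) g))

  module _ {m : ℕ} where
    differ : Fin m → Fin m → Bool
    differ c d = not (does (c Fin.≟ d))

    countDiffering : ∀ {n} → Fin m → Subset n → (Fin n → Fin m) → ℕ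
    countDiffering c []      cl = 0
    countDiffering c (g ∷ G) cl = indicator g * indicator (differ c (cl zero)) + countDiffering c G (cl ∘ suc)

    -- Recursion over the smaller member of a pair, which is how the program counts; `P` itself
    -- filters a list of all pairs.
    countPairs : ∀ {n} → Subset n → (Fin n → Fin m) → ℕ
    countPairs []      cl = 0
    countPairs (g ∷ G) cl = indicator g * countDiffering (cl zero) G (cl ∘ suc) + countPairs G (cl ∘ suc)

    -- The Boolean to which the decision `separatedPair?` reduces, so that `P≡countPairs` can chain
    -- the two sums without a conversion.
    separated : ∀ {n} → Subset n → (Fin n → Fin m) → Fin n → Fin n → Bool
    separated G cl i j = does (i Fin.<? j) ∧ does (i ∈? G) ∧ does (j ∈? G) ∧ differ (cl i) (cl j)

    sum-differing : ∀ {n} c (G : Subset n) cl →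
      sum (λ j → indicator (does (j ∈? G) ∧ differ c (cl j))) ≡ countDiffering c G cl
    sum-differing c []            cl = refl
    sum-differing c (inside  ∷ G) cl = cong₂ _+_
      (sym (*-identityˡ (indicator (differ c (cl zero))))) (sum-differing c G (cl ∘ suc))
    sum-differing c (outside ∷ G) cl = sum-differing c G (cl ∘ suc)

    sum-separated : ∀ {n} (G : Subset n) cl →
      sum (λ i → sum (λ j → indicator (separated G cl i j))) ≡ countPairs G cl
    sum-separated []            cl = refl
    sum-separated (inside  ∷ G) cl = cong₂ _+_
      (trans (sum-differing (cl zero) G (cl ∘ suc)) (sym (*-identityˡ _))) (sum-separated G (cl ∘ suc))
    sum-separated {suc n} (outside ∷ G) cl = cong₂ _+_ (sum-replicate-zero n) (sum-separated G (cl ∘ suc))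

    countDiffering-≤ : ∀ {n} c (G : Subset n) cl → countDiffering c G cl ≤ n
    countDiffering-≤ c []      cl = z≤n
    countDiffering-≤ c (g ∷ G) cl = +-mono-≤
      (*-mono-≤ (indicator≤1 g) (indicator≤1 (differ c (cl zero)))) (countDiffering-≤ c G (cl ∘ suc))

    -- There are at most n (n - 1) / 2 pairs. The summand `n` stands on the left to avoid
    -- subtraction and, as soon as there is an object, supplies the 1 in `1+2P≤n²`.
    2*countPairs+n≤n² : ∀ {n} (G : Subset n) cl → 2 * countPairs G cl + n ≤ n * n
    2*countPairs+n≤n² []              cl = z≤n
    2*countPairs+n≤n² {suc n} (g ∷ G) cl = begin
      2 * (indicator g * c + p) + suc n  ≤⟨ +-monoˡ-≤ (suc n) (*-monoʳ-≤ 2 (+-monoˡ-≤ p g*c≤n)) ⟩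
      2 * (n + p) + suc n                ≡⟨ rearrange n p ⟩
      suc (n + n) + (2 * p + n)          ≤⟨ +-monoʳ-≤ (suc (n + n)) (2*countPairs+n≤n² G (cl ∘ suc)) ⟩
      suc (n + n) + n * n                ≡⟨ square n ⟩
      suc n * suc n                      ∎
      where
      open ≤-Reasoning
      c = countDiffering (cl zero) G (cl ∘ suc)
      p = countPairs G (cl ∘ suc)
      g*c≤c : ∀ b → indicator b * c ≤ c
      g*c≤c true  = ≤-reflexive (*-identityˡ c)
      g*c≤c false = z≤n
      g*c≤n : indicator g * c ≤ n
      g*c≤n = ≤-trans (g*c≤c g) (countDiffering-≤ (cl zero) G (cl ∘ suc))
      rearrange : ∀ n p → 2 * (n + p) + suc n ≡ suc (n + n) + (2 * p + n)
      rearrange = solve-∀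
      square : ∀ n → suc (n + n) + n * n ≡ suc n * suc n
      square = solve-∀

  module _ {ℓ : ℕ} (I : Instance ℓ) where
    open Instance I

    P≡countPairs : ∀ G → P I G ≡ countPairs G class
    P≡countPairs G = trans (count-cartesianProduct (separatedPair? I G) id id) (sum-separated G class)

    P≤n² : ∀ G → P I G ≤ n * n
    P≤n² G = subst (_≤ n * n) (sym (P≡countPairs G))
      (≤-trans (m≤m+n _ _) (≤-trans (m≤m+n _ n) (2*countPairs+n≤n² G class)))

    1+2P≤n² : ∀ G → Nonempty G → 1 + 2 * P I G ≤ n * n
    1+2P≤n² G (s , _) = subst (λ p → 1 + 2 * p ≤ n * n) (sym (P≡countPairs G))
      (≤-trans (subst (_≤ 2 * countPairs G class + n) (+-comm (2 * countPairs G class) 1)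
                 (+-monoʳ-≤ (2 * countPairs G class) (n>0 s)))
        (2*countPairs+n≤n² G class))
      where
      n>0 : ∀ {n} → Fin n → 1 ≤ n
      n>0 zero    = s≤s z≤n
      n>0 (suc _) = s≤s z≤n

    ∈-branch⁺ : ∀ {G t i s} → s ∈ G → outcome t s ≡ i → s ∈ branch I G t i
    ∈-branch⁺ {G} {t} {i} {s} s∈G eq = x∈p∩q⁺ (s∈G , lookup⇒[]= s _
      (trans (lookup∘tabulate _ s) (dec-true (outcome t s Fin.≟ i) eq)))

    ∈-branch⁻ : ∀ {G t i s} → s ∈ branch I G t i → s ∈ G × outcome t s ≡ i
    ∈-branch⁻ {G} {t} {i} {s} s∈
      with x∈p∩q⁻ G _ s∈ | outcome t s Fin.≟ i
         | trans (sym (lookup∘tabulate (λ s → does (outcome t s Fin.≟ i)) s)) ([]=⇒lookup (proj₂ (x∈p∩q⁻ G _ s∈)))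
    ... | s∈G , _ | yes eq | _  = s∈G , eq
    ... | s∈G , _ | no _   | ()

    branch-⊆ : ∀ {G t i} → branch I G t i ⊆ G
    branch-⊆ s∈ = proj₁ (∈-branch⁻ s∈)

    branch-mono : ∀ {F G t i} → F ⊆ G → branch I F t i ⊆ branch I G t i
    branch-mono F⊆G s∈ = let s∈F , eq = ∈-branch⁻ s∈ in ∈-branch⁺ (F⊆G s∈F) eq

    SeparatedPair-mono : ∀ {F G} → F ⊆ G → ∀ {p} → SeparatedPair I F p → SeparatedPair I G p
    SeparatedPair-mono F⊆G (s<s′ , s∈ , s′∈ , c≢) = s<s′ , F⊆G s∈ , F⊆G s′∈ , c≢

    allPairs : List (Fin n × Fin n)
    allPairs = cartesianProduct (allFin n) (allFin n)

    ∈-allPairs : ∀ p → p ∈ᴸ allPairs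
    ∈-allPairs (s , s′) = ∈-cartesianProduct⁺ (∈-allFin s) (∈-allFin s′)

    P-mono : ∀ {F G} → F ⊆ G → P I F ≤ P I G
    P-mono {F} {G} F⊆G = count-mono (separatedPair? I F) (separatedPair? I G) (SeparatedPair-mono F⊆G) allPairs

    -- A pair of `F` in the branch of `G` is a pair in the branch of `F`, since a branch depends on
    -- outcomes only. Rearranged, the answer `i` eliminates at most as many pairs of `F` as of `G`;
    -- a rate fixed for `G` thus remains valid on all its subsets.
    P-branch : ∀ {F G} t i → F ⊆ G → P I F + P I (branch I G t i) ≤ P I G + P I (branch I F t i)
    P-branch {F} {G} t i F⊆G = count-exchange
      (separatedPair? I F) (separatedPair? I (branch I G t i))
      (separatedPair? I G) (separatedPair? I (branch I F t i))
      (SeparatedPair-mono F⊆G) (SeparatedPair-mono branch-⊆)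
      (λ (s<s′ , s∈F , s′∈F , c≢) (_ , s∈ , s′∈ , _) →
        s<s′ , ∈-branch⁺ s∈F (proj₂ (∈-branch⁻ s∈)) , ∈-branch⁺ s′∈F (proj₂ (∈-branch⁻ s′∈)) , c≢)
      allPairs

    Homogeneous⇒P≡0 : ∀ {G} → Homogeneous I G → P I G ≡ 0
    Homogeneous⇒P≡0 {G} (j , class≡j) = count-none (separatedPair? I G)
      (λ (s , s′) (_ , s∈G , s′∈G , c≢) → c≢ (trans (class≡j s∈G) (sym (class≡j s′∈G)))) allPairs

    P≡0⇒same-class : ∀ {G} → P I G ≡ 0 → ∀ {s s′} → s ∈ G → s′ ∈ G → class s ≡ class s′
    P≡0⇒same-class {G} P≡0 {s} {s′} s∈G s′∈G with class s Fin.≟ class s′ | Fin.<-cmp s s′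
    ... | yes eq | _           = eq
    ... | no c≢ | tri≈ _ eq _ = cong class eq
    ... | no c≢ | tri< s<s′ _ _ = contradiction (s<s′ , s∈G , s′∈G , c≢)
      (count≡0⇒¬ (separatedPair? I G) P≡0 (∈-allPairs (s , s′)))
    ... | no c≢ | tri> _ _ s′<s = contradiction (s′<s , s′∈G , s∈G , c≢ ∘ sym)
      (count≡0⇒¬ (separatedPair? I G) P≡0 (∈-allPairs (s′ , s)))

    P≡0⇒Homogeneous : ∀ {G} → Nonempty G → P I G ≡ 0 → Homogeneous I G
    P≡0⇒Homogeneous (s₀ , s₀∈G) P≡0 = class s₀ , λ s∈G → P≡0⇒same-class P≡0 s∈G s₀∈G

    ∃separated : ∀ {G} → Nonempty G → ¬ Homogeneous I G → ∃[ p ] SeparatedPair I G p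
    ∃separated {G} ne ¬hom with Fin.any? (λ s → Fin.any? (λ s′ → separatedPair? I G (s , s′)))
    ... | yes (s , s′ , sep) = (s , s′) , sep
    ... | no ¬sep = contradiction
      (P≡0⇒Homogeneous ne (count-none (separatedPair? I G) (λ (s , s′) sep → ¬sep (s , s′ , sep)) allPairs)) ¬hom

    -- A test that distinguishes the two objects of a separated pair sends them to different
    -- branches, so every branch lacks this pair. It keeps the greedy minimum finite and gives the
    -- search for an optimal tree a splitting test to start from.
    ∃progress : ∀ {G} → Nonempty G → ¬ Homogeneous I G → ∃[ t ] (∀ i → P I (branch I G t i) < P I G)
    ∃progress {G} ne ¬hom with ∃separated ne ¬hom
    ... | (s , s′) , sep@(s<s′ , s∈G , s′∈G , c≢) = t , λ i →
      count-mono-< (separatedPair? I (branch I G t i)) (separatedPair? I G)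
        (SeparatedPair-mono branch-⊆) (∈-allPairs (s , s′)) sep
        (λ (_ , s∈ , s′∈ , _) → o≢ (trans (proj₂ (∈-branch⁻ s∈)) (sym (proj₂ (∈-branch⁻ s′∈)))))
      where
      split = complete s s′ (Fin.<⇒≢ s<s′)
      t = proj₁ split
      o≢ = proj₂ split

-- The approximation factor of the greedy tree

module Approximation where
  open Rationals
  open Logarithm
  open SeparatedPairs
  open import Data.Nat.Base as ℕ using (ℕ; zero; suc; _∸_)
  import Data.Nat.Properties as ℕ
  open import Data.Rational.Base hiding (truncate)
  open import Data.Rational.Properties
  open import Data.Rational.Solver using (module +-*-Solver)
  open import Data.Fin.Base using (Fin; zero; suc)
  open import Data.Fin.Subset using (Subset; _∈_; _⊆_; ⊤; Nonempty)
  open import Data.Fin.Subset.Properties using (_∈?_; nonempty?; ∈⊤)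
  open import Data.List.Base using ([]; _∷_; map; filter; foldr; allFin; tabulate)
  open import Data.List.Membership.Propositional using () renaming (_∈_ to _∈ᴸ_)
  open import Data.List.Membership.Propositional.Properties using (∈-allFin; ∈-filter⁺; ∈-filter⁻; ∈-map⁺; ∈-map⁻)
  open import Data.List.Relation.Unary.Any using (here; there)
  open import Data.Product.Base using (_×_; _,_; ∃-syntax; proj₂)
  open import Data.Sum.Base using (_⊎_; inj₁; inj₂)
  open import Function.Base using (_∘_)
  open import Relation.Nullary using (yes; no; contradiction; ¬_)
  open import Relation.Nullary.Construct.Add.Supremum using (_⁺; ⊤⁺; [_])
  open import Relation.Binary.Construct.Add.Supremum.NonStrict _≤_ using (_≤⁺_; [_]; _≤⊤⁺)
  open import Relation.Binary.PropositionalEquality hiding ([_])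
  open +-*-Solver using (_:=_; _:+_; _:*_; con) renaming (solve to solveℚ)

  maxℚ-upper : ∀ {x xs} → x ∈ᴸ xs → x ≤ maxℚ xs
  maxℚ-upper {xs = y ∷ ys} (here refl)  = p≤p⊔q y (maxℚ ys)
  maxℚ-upper {xs = y ∷ ys} (there x∈ys) = ≤-trans (maxℚ-upper x∈ys) (p≤q⊔p y (maxℚ ys))

  maxℚ-least : ∀ {v xs} → 0ℚ ≤ v → (∀ {x} → x ∈ᴸ xs → x ≤ v) → maxℚ xs ≤ v
  maxℚ-least {xs = []}     0≤v xs≤v = 0≤v
  maxℚ-least {xs = x ∷ xs} 0≤v xs≤v = ⊔-lub (xs≤v (here refl)) (maxℚ-least 0≤v (xs≤v ∘ there))

  0≤maxℚ : ∀ xs → 0ℚ ≤ maxℚ xs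
  0≤maxℚ []       = ≤-refl
  0≤maxℚ (x ∷ xs) = ≤-trans (0≤maxℚ xs) (p≤q⊔p x (maxℚ xs))

  recip-cancel : ∀ c d → c * recip d * fromℕ (suc d) ≡ c
  recip-cancel c d = trans (*-assoc c (recip d) (fromℕ (suc d)))
    (trans (cong (c *_) (recip-inverse d)) (*-identityʳ c))

  -- The inequality ρ d ≤ opt (H (d + b) - H b) without subtraction.
  H-increment : ∀ {ρ opt a} b d → 0ℚ ≤ ρ → ρ * fromℕ a ≤ opt → d ℕ.+ b ℕ.≤ a →
                ρ * fromℕ d + H b * opt ≤ H (d ℕ.+ b) * opt
  H-increment {ρ} {opt} b zero 0≤ρ ρa≤opt b≤a = ≤-reflexive
    (trans (cong (_+ H b * opt) (*-zeroʳ ρ)) (+-identityˡ _))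
  H-increment {ρ} {opt} {a} b (suc d) 0≤ρ ρa≤opt d+b<a = begin
    ρ * fromℕ (suc d) + H b * opt
      ≡⟨ cong (λ z → ρ * z + H b * opt) (fromℕ-suc d) ⟩
    ρ * (1ℚ + fromℕ d) + H b * opt
      ≡⟨ solveℚ 3 (λ ρ d h → ρ :* (con 1ℚ :+ d) :+ h := (ρ :* d :+ h) :+ ρ) refl ρ (fromℕ d) (H b * opt) ⟩
    (ρ * fromℕ d + H b * opt) + ρ
      ≤⟨ +-mono-≤ (H-increment b d 0≤ρ ρa≤opt (ℕ.<⇒≤ d+b<a)) ρ≤ ⟩
    H (d ℕ.+ b) * opt + recip (d ℕ.+ b) * opt
      ≡⟨ sym (*-distribʳ-+ opt (H (d ℕ.+ b)) (recip (d ℕ.+ b))) ⟩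
    H (suc d ℕ.+ b) * opt ∎
    where
    open ≤-Reasoning
    ρ≤ : ρ ≤ recip (d ℕ.+ b) * opt
    ρ≤ = cancelʳ-fromℕ-suc (d ℕ.+ b) (begin
      ρ * fromℕ (suc (d ℕ.+ b))
        ≤⟨ *-monoˡ 0≤ρ (fromℕ-mono d+b<a) ⟩
      ρ * fromℕ a
        ≤⟨ ρa≤opt ⟩
      opt
        ≡⟨ sym (*-identityˡ opt) ⟩
      1ℚ * opt
        ≡⟨ cong (_* opt) (sym (recip-inverse (d ℕ.+ b))) ⟩
      recip (d ℕ.+ b) * fromℕ (suc (d ℕ.+ b)) * opt
        ≡⟨ solveℚ 3 (λ r n o → r :* n :* o := r :* o :* n) refl (recip (d ℕ.+ b)) (fromℕ (suc (d ℕ.+ b))) opt ⟩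
      recip (d ℕ.+ b) * opt * fromℕ (suc (d ℕ.+ b)) ∎)

  -- Wrapped inequalities: the counts are recovered by unification and never unfolded.
  infix 4 _·_≤*_ _≤*_·_ _≤*H_·_

  record _·_≤*_ (ρ : ℚ) (d : ℕ) (c : ℚ) : Set where
    constructor wrap
    field unwrap : ρ * fromℕ d ≤ c

  record _≤*_·_ (c ρ : ℚ) (d : ℕ) : Set where
    constructor wrap
    field unwrap : c ≤ ρ * fromℕ d

  record _≤*H_·_ (c : ℚ) (a : ℕ) (v : ℚ) : Set where
    constructor wrap
    field unwrap : c ≤ H a * v

  ·-≤-trans : ∀ {ρ d c c′} → ρ · d ≤* c → c ≤ c′ → ρ · d ≤* c′
  ·-≤-trans (wrap ρd≤c) c≤c′ = wrap (≤-trans ρd≤c c≤c′)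

  ·-zero : ∀ {ρ d c} → d ≡ 0 → 0ℚ ≤ c → ρ · d ≤* c
  ·-zero {ρ} refl 0≤c = wrap (≤-trans (≤-reflexive (*-zeroʳ ρ)) 0≤c)

  ·-nonPos : ∀ {ρ d c} → ρ ≤ 0ℚ → 0ℚ ≤ c → ρ · d ≤* c
  ·-nonPos {ρ} {d} ρ≤0 0≤c = wrap
    (≤-trans (*-monoʳ (0≤fromℕ d) ρ≤0) (≤-trans (≤-reflexive (*-zeroˡ (fromℕ d))) 0≤c))

  -- Cancelling `gᵢ` gives `p ≤ d + pᵢ`: the test, priced by the pairs of `G` it eliminates, pays
  -- for those lost by `F`, and the subtree pays for those that remain.
  charge-exchange : ∀ {ρ c x p pᵢ g gᵢ d} → 0ℚ ≤ ρ → d ℕ.+ gᵢ ≡ g → p ℕ.+ gᵢ ℕ.≤ g ℕ.+ pᵢ →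
                    ρ · d ≤* c → ρ · pᵢ ≤* x → ρ · p ≤* c + x
  charge-exchange {ρ} {c} {x} {p} {pᵢ} {_} {gᵢ} {d} 0≤ρ refl exchange (wrap ρd≤c) (wrap ρpᵢ≤x) = wrap (begin
    ρ * fromℕ p                  ≤⟨ *-monoˡ 0≤ρ (fromℕ-mono p≤) ⟩
    ρ * fromℕ (d ℕ.+ pᵢ)         ≡⟨ trans (cong (ρ *_) (fromℕ-+ d pᵢ)) (*-distribˡ-+ ρ (fromℕ d) (fromℕ pᵢ)) ⟩
    ρ * fromℕ d + ρ * fromℕ pᵢ   ≤⟨ +-mono-≤ ρd≤c ρpᵢ≤x ⟩
    c + x                        ∎)
    where
    open ≤-Reasoning
    p≤ : p ℕ.≤ d ℕ.+ pᵢ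
    p≤ = ℕ.+-cancelʳ-≤ gᵢ p (d ℕ.+ pᵢ) (ℕ.≤-trans exchange (ℕ.≤-reflexive
      (trans (ℕ.+-assoc d gᵢ pᵢ) (trans (cong (d ℕ.+_) (ℕ.+-comm gᵢ pᵢ)) (sym (ℕ.+-assoc d pᵢ gᵢ))))))

  -- `H a - H b` consists of `d` reciprocals, none below 1 / a; since `ρ · a ≤* v`, multiplying it
  -- by `v` yields at least `ρ` for each of them.
  charge-H : ∀ {ρ v c c′ a b d} → 0ℚ ≤ ρ → ρ · a ≤* v → d ℕ.+ b ≡ a →
             c ≤* ρ · d → c′ ≤*H b · v → c + c′ ≤*H a · v
  charge-H {b = b} {d} 0≤ρ (wrap ρa≤v) refl (wrap c≤) (wrap c′≤) =
    wrap (≤-trans (+-mono-≤ c≤ c′≤) (H-increment b d 0≤ρ ρa≤v ℕ.≤-refl))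

  module _ {ℓ : ℕ} (I : Instance ℓ) where
    open Instance I

    0≤testCost : ∀ t i → 0ℚ ≤ testCost t i
    0≤testCost t i = <⇒≤ (testCost-positive t i)

    mutual
      0≤cost : ∀ {G} (D : DecTree I G) s → 0ℚ ≤ cost I D s
      0≤cost (leaf _ _)    s = ≤-refl
      0≤cost (node _ t ch) s = 0≤+ (0≤testCost t (outcome t s)) (0≤childCost (ch (outcome t s)) s)

      0≤childCost : ∀ {G} (D : Child I G) s → 0ℚ ≤ childCost I D s
      0≤childCost (absent _)    s = ≤-refl
      0≤childCost (present _ D) s = 0≤cost D s

    cost≤costW : ∀ {G} (D : DecTree I G) {s} → s ∈ G → cost I D s ≤ costW I D
    cost≤costW {G} D {s} s∈G = maxℚ-upper (∈-map⁺ (cost I D) (∈-filter⁺ (_∈? G) (∈-allFin s) s∈G))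

    costW-least : ∀ {G} (D : DecTree I G) {v} → 0ℚ ≤ v → (∀ {s} → s ∈ G → cost I D s ≤ v) → costW I D ≤ v
    costW-least {G} D {v} 0≤v bound = maxℚ-least 0≤v λ x∈ → let s , s∈ , eq = ∈-map⁻ (cost I D) x∈ in
      subst (_≤ v) (sym eq) (bound (proj₂ (∈-filter⁻ (_∈? G) {xs = allFin n} s∈)))

    0≤costW : ∀ {G} (D : DecTree I G) → 0ℚ ≤ costW I D
    0≤costW {G} D = 0≤maxℚ (map (cost I D) (filter (_∈? G) (allFin n)))

    cost-node : ∀ {G ¬hom t ch s i} → outcome t s ≡ i →
                cost I {G} (node ¬hom t ch) s ≡ testCost t i + childCost I (ch i) s
    cost-node refl = refl

    separatedBy : Subset n → Fin k → Fin ℓ → ℕ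
    separatedBy G t i = P I G ∸ P I (branch I G t i)

    separatedBy+P : ∀ G t i → separatedBy G t i ℕ.+ P I (branch I G t i) ≡ P I G
    separatedBy+P G t i = ℕ.m∸n+n≡m (P-mono I (branch-⊆ I))

    divide-≥ : ∀ {c ρ} d → 0ℚ ≤ c → [ ρ ] ≤⁺ divide I c d → ρ · d ≤* c
    -- An infinite ratio arises only where no pair is eliminated, and then nothing is charged.
    divide-≥ {c} {ρ} zero    0≤c _      = ·-zero {ρ} refl 0≤c
    divide-≥ {c} {ρ} (suc d) 0≤c [ ρ≤ ] = wrap
      (≤-trans (*-monoʳ (0≤fromℕ (suc d)) ρ≤) (≤-reflexive (recip-cancel c d)))

    divide-≤ : ∀ {c x ρ} d → divide I c d ≡ [ x ] → x ≤ ρ → c ≤* ρ · d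
    divide-≤ {c} (suc d) refl x≤ρ = wrap
      (≤-trans (≤-reflexive (sym (recip-cancel c d))) (*-monoʳ (0≤fromℕ (suc d)) x≤ρ))

    max⁺ : ∀ {k} → (Fin k → ℚ ⁺) → ℚ ⁺
    max⁺ f = foldr (_⊔⁺_ I) [ 0ℚ ] (tabulate f)

    max⁺-finite : ∀ {k} (f : Fin k → ℚ ⁺) → (∀ i → ∃[ x ] f i ≡ [ x ]) → ∃[ x ] max⁺ f ≡ [ x ]
    max⁺-finite {zero}  f fin = 0ℚ , refl
    max⁺-finite {suc k} f fin with fin zero | max⁺-finite (f ∘ suc) (fin ∘ suc)
    ... | x , eq | y , eq′ rewrite eq | eq′ = x ⊔ y , refl

    max⁺-upper : ∀ {k} (f : Fin k → ℚ ⁺) {ρ} → max⁺ f ≡ [ ρ ] → ∀ i → ∃[ x ] f i ≡ [ x ] × x ≤ ρ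
    max⁺-upper f eq zero with f zero | max⁺ (f ∘ suc) | eq
    ... | [ x ] | [ y ] | refl = x , refl , p≤p⊔q x y
    ... | [ x ] | ⊤⁺    | ()
    max⁺-upper f eq (suc i) with f zero | max⁺ (f ∘ suc) in eq′ | eq
    ... | [ x ] | [ y ] | refl = let z , fi≡z , z≤y = max⁺-upper (f ∘ suc) eq′ i in
      z , fi≡z , ≤-trans z≤y (p≤q⊔p x y)
    ... | [ x ] | ⊤⁺    | ()

    0≤max⁺ : ∀ {k} (f : Fin k → ℚ ⁺) {ρ} → max⁺ f ≡ [ ρ ] → 0ℚ ≤ ρ
    0≤max⁺ {zero}  f refl = ≤-refl
    0≤max⁺ {suc k} f eq with f zero | max⁺ (f ∘ suc) in eq′ | eq
    ... | [ x ] | [ y ] | refl = ≤-trans (0≤max⁺ (f ∘ suc) eq′) (p≤q⊔p x y)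
    ... | [ x ] | ⊤⁺    | ()

    -- The fold starts from 0, so its value may be this 0 and belong to no index; then `ρ ≤ 0ℚ`, and
    -- a charge at rate `ρ` is covered by any cost through `·-nonPos`.
    max⁺-attained : ∀ {k} (f : Fin (suc k) → ℚ ⁺) {ρ} → [ ρ ] ≤⁺ max⁺ f → ρ ≤ 0ℚ ⊎ ∃[ i ] [ ρ ] ≤⁺ f i
    max⁺-attained f {ρ} ρ≤ with f zero in eq
    ... | ⊤⁺    = inj₂ (zero , subst ([ ρ ] ≤⁺_) (sym eq) (_ ≤⊤⁺))
    max⁺-attained {zero} f {ρ} [ ρ≤ ] | [ x ] with ρ ≤? x
    ... | yes ρ≤x = inj₂ (zero , subst ([ ρ ] ≤⁺_) (sym eq) [ ρ≤x ])
    ... | no ρ≰x with ≤-total x 0ℚ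
    ...   | inj₁ x≤0 = inj₁ (subst (ρ ≤_) (p≤q⇒p⊔q≡q x≤0) ρ≤)
    ...   | inj₂ 0≤x = contradiction (subst (ρ ≤_) (p≥q⇒p⊔q≡p 0≤x) ρ≤) ρ≰x
    max⁺-attained {suc k} f {ρ} ρ≤ | [ x ] with ρ ≤? x
    ... | yes ρ≤x = inj₂ (zero , subst ([ ρ ] ≤⁺_) (sym eq) [ ρ≤x ])
    ... | no ρ≰x with max⁺-attained (f ∘ suc) (drop-head (max⁺ (f ∘ suc)) ρ≤)
      where
      drop-head : ∀ y → [ ρ ] ≤⁺ _⊔⁺_ I [ x ] y → [ ρ ] ≤⁺ y
      drop-head ⊤⁺    _      = _ ≤⊤⁺
      drop-head [ y ] [ ρ≤ ] with ≤-total x y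
      ... | inj₁ x≤y = [ subst (ρ ≤_) (p≤q⇒p⊔q≡q x≤y) ρ≤ ]
      ... | inj₂ y≤x = contradiction (subst (ρ ≤_) (p≥q⇒p⊔q≡p y≤x) ρ≤) ρ≰x
    ...   | inj₁ ρ≤0        = inj₁ ρ≤0
    ...   | inj₂ (i , ρ≤fi) = inj₂ (suc i , ρ≤fi)

    maxRatio-finite⇒P< : ∀ {G t ρ} → maxRatio I G t ≡ [ ρ ] → ∀ i → P I (branch I G t i) ℕ.< P I G
    maxRatio-finite⇒P< {G} {t} fin i with separatedBy G t i in eq | max⁺-upper (ratio I G t) fin i
    ... | zero  | _ , () , _
    ... | suc d | _ = ℕ.m∸n≢0⇒n<m λ eq′ → contradiction (trans (sym eq) eq′) λ ()

    -- Completeness enters here: the test of `∃progress` has only finite ratios, and the minimal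
    -- test is no worse.
    DividePairs-node-finite : ∀ {G} → Nonempty G → ¬ Homogeneous I G → ∀ {t} →
      (∀ t′ → maxRatio I G t ≤⁺ maxRatio I G t′) → ∃[ ρ ] maxRatio I G t ≡ [ ρ ]
    DividePairs-node-finite {G} ne ¬hom {t} min with ∃progress I ne ¬hom
    ... | t′ , P< with maxRatio I G t | maxRatio I G t′ | min t′ | max⁺-finite (ratio I G t′) finite
      where
      finite : ∀ i → ∃[ x ] ratio I G t′ i ≡ [ x ]
      finite i with separatedBy G t′ i | ℕ.m<n⇒0<n∸m (P< i)
      ... | suc d | _ = _ , refl
    ...   | [ ρ ] | _ | _ | _ = ρ , refl
    ...   | ⊤⁺ | .⊤⁺ | _ ≤⊤⁺ | _ , ()

  Fin2-≢ : ∀ {i j x : Fin 2} → i ≢ j → x ≢ i → x ≡ j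
  Fin2-≢ {zero}     {zero}     {_}        i≢j x≢i = contradiction refl i≢j
  Fin2-≢ {zero}     {suc zero} {zero}     i≢j x≢i = contradiction refl x≢i
  Fin2-≢ {zero}     {suc zero} {suc zero} i≢j x≢i = refl
  Fin2-≢ {suc zero} {zero}     {zero}     i≢j x≢i = refl
  Fin2-≢ {suc zero} {zero}     {suc zero} i≢j x≢i = contradiction refl x≢i
  Fin2-≢ {suc zero} {suc zero} {_}        i≢j x≢i = contradiction refl i≢j

  other : (i : Fin 2) → ∃[ j ] i ≢ j
  other zero       = suc zero , λ ()
  other (suc zero) = zero , λ ()

  module _ (I : Instance 2) where
    open Instance I

    -- An adversary's strategy: to each test it has an answer `i` that costs at least `ρ` for every
    -- pair of `G` that this answer eliminates.
    Unavoidable : Subset n → ℚ → Set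
    Unavoidable G ρ = ∀ t → ∃[ i ] ρ · separatedBy I G t i ≤* testCost t i

    -- An object of F that takes, as long as F splits, the branch of each test on
    -- which that test pays at least ρ for every pair of G it separates.
    mutual
      cost-lower-bound : ∀ {F F′ G} (D : DecTree I F′) {ρ} → 0ℚ ≤ ρ → Unavoidable G ρ →
        F ⊆ G → F ⊆ F′ → Nonempty F → ∃[ s ] s ∈ F × ρ · P I F ≤* cost I D s
      cost-lower-bound {F} (leaf j class≡j) 0≤ρ bad F⊆G F⊆F′ (s , s∈F) = s , s∈F ,
        ·-zero (Homogeneous⇒P≡0 I (j , class≡j ∘ F⊆F′)) ≤-refl
      cost-lower-bound {F} {F′} {G} (node ¬hom t ch) {ρ} 0≤ρ bad F⊆G F⊆F′ ne with bad t
      ... | i , ρd≤c with nonempty? (branch I F t i)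
      ...   | yes neᵢ =
        let s , s∈Fᵢ , bound = childCost-lower-bound (ch i) 0≤ρ bad (F⊆G ∘ branch-⊆ I) (branch-mono I F⊆F′) neᵢ
            s∈F , o≡i = ∈-branch⁻ I s∈Fᵢ
        in s , s∈F , subst (ρ · P I F ≤*_) (sym (cost-node I {¬hom = ¬hom} {ch = ch} o≡i))
             (charge-exchange 0≤ρ (separatedBy+P I G t i) (P-branch I t i F⊆G) ρd≤c bound)
      ...   | no ¬neᵢ =
        let j , i≢j = other i
            o≡j : ∀ {s} → s ∈ F → outcome t s ≡ j
            o≡j s∈F = Fin2-≢ i≢j λ o≡i → ¬neᵢ (_ , ∈-branch⁺ I s∈F o≡i)
            s , s∈F , bound = childCost-lower-bound (ch j) 0≤ρ bad F⊆G
                                (λ s∈F → ∈-branch⁺ I (F⊆F′ s∈F) (o≡j s∈F)) ne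
        in s , s∈F , ·-≤-trans bound
             (≤-trans (q≤p+q (0≤testCost I t j))
               (≤-reflexive (sym (cost-node I {¬hom = ¬hom} {ch = ch} (o≡j s∈F)))))

      childCost-lower-bound : ∀ {F F′ G} (D : Child I F′) {ρ} → 0ℚ ≤ ρ → Unavoidable G ρ →
        F ⊆ G → F ⊆ F′ → Nonempty F → ∃[ s ] s ∈ F × ρ · P I F ≤* childCost I D s
      childCost-lower-bound (absent empty) 0≤ρ bad F⊆G F⊆F′ (s , s∈F) = contradiction (s , F⊆F′ s∈F) empty
      childCost-lower-bound (present _ D)  0≤ρ bad F⊆G F⊆F′ ne        = cost-lower-bound D 0≤ρ bad F⊆G F⊆F′ ne

    minRatio-unavoidable : ∀ {G ρ} → (∀ t → [ ρ ] ≤⁺ maxRatio I G t) → Unavoidable G ρ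
    minRatio-unavoidable {G} min t with max⁺-attained I (ratio I G t) (min t)
    ... | inj₂ (i , ρ≤) = i , divide-≥ I (separatedBy I G t i) (0≤testCost I t i) ρ≤
    -- For a rate that is not positive any answer will do.
    ... | inj₁ ρ≤0      = zero , ·-nonPos ρ≤0 (0≤testCost I t zero)

    module _ (D* : DecTree I ⊤) where
      opt : ℚ
      opt = costW I D*

      mutual
        cost-upper-bound : ∀ {G} {D : DecTree I G} → DividePairs I D → ∀ {s} → s ∈ G → cost I D s ≤*H P I G · opt
        cost-upper-bound {G} leaf s∈G = wrap (0≤* (0≤H (P I G)) (0≤costW I D*))
        cost-upper-bound {G} (node {h = ¬hom} {t} {ch} min greedy) {s} s∈G
          with DividePairs-node-finite I (s , s∈G) ¬hom min
        ... | ρ , finite with max⁺-upper I (ratio I G t) finite (outcome t s)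
        ...   | x , r≡x , x≤ρ = charge-H 0≤ρ ρP≤opt (separatedBy+P I G t i)
          (divide-≤ I (separatedBy I G t i) r≡x x≤ρ)
          (childCost-upper-bound (greedy i) (∈-branch⁺ I s∈G refl))
          where
          i = outcome t s
          0≤ρ : 0ℚ ≤ ρ
          0≤ρ = 0≤max⁺ I (ratio I G t) finite
          ρP≤opt : ρ · P I G ≤* opt
          ρP≤opt =
            -- The adversary plays against the tree for all objects but starts from `G` only, so the
            -- cost of `D*` bounds the subproblem at this node as well.
            let _ , _ , bound = cost-lower-bound D* 0≤ρ
                  (minRatio-unavoidable λ t′ → subst (_≤⁺ maxRatio I G t′) finite (min t′))
                  (λ s∈ → s∈) (λ _ → ∈⊤) (s , s∈G)
            in ·-≤-trans bound (cost≤costW I D* ∈⊤)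

        childCost-upper-bound : ∀ {G} {D : Child I G} → DividePairsChild I D →
                                 ∀ {s} → s ∈ G → childCost I D s ≤*H P I G · opt
        childCost-upper-bound (absent {h = empty}) s∈G = contradiction (_ , s∈G) empty
        childCost-upper-bound (present greedy)     s∈G = cost-upper-bound greedy s∈G

      DividePairs-approx : ∀ {D : DecTree I ⊤} → DividePairs I D → costW I D ≤ H (P I ⊤) * opt
      DividePairs-approx {D} greedy = costW-least I D
        (0≤* (0≤H (P I ⊤)) (0≤costW I D*)) (λ s∈⊤ → _≤*H_·_.unwrap (cost-upper-bound greedy s∈⊤))

-- Existence of an optimal tree

module Optimum where
  open Rationals
  open SeparatedPairs
  open Approximation
  open import Data.Nat.Base as ℕ using (zero; suc)
  import Data.Nat.Properties as ℕ
  open import Data.Rational.Base hiding (truncate; ∣_∣)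
  open import Data.Rational.Properties
  open import Data.Fin.Base using (Fin; zero; suc)
  import Data.Fin.Properties as Fin
  open import Data.Fin.Subset using (Subset; _∈_; ∣_∣; Nonempty)
  open import Data.Fin.Subset.Properties using (_∈?_; nonempty?; ⊆-antisym; p⊂q⇒∣p∣<∣q∣; ∣⊥∣≡0; ⊥⊆; ∉⊥)
  open import Data.List.Base using (List; []; _∷_; allFin; tabulate)
  open import Relation.Binary.Bundles using (module DecTotalOrder)
  open import Data.List.Extrema (DecTotalOrder.totalOrder ≤-decTotalOrder) using (argmin; f[argmin]≤f[xs])
  open import Data.List.Membership.Propositional using () renaming (_∈_ to _∈ᴸ_)
  open import Data.List.Membership.Propositional.Properties using (∈-tabulate⁺; ∈-map⁻; ∈-filter⁻)
  open import Data.List.Relation.Unary.Any using (here; there)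
  import Data.List.Relation.Unary.All as All
  open import Data.Product.Base using (_,_; Σ-syntax; proj₁; proj₂)
  open import Data.Sum.Base using (inj₁; inj₂)
  open import Function.Base using (_∘_)
  open import Relation.Nullary using (Dec; yes; no; contradiction; ¬_)
  open import Relation.Binary.PropositionalEquality

  -- `maxℚ` of the empty list is 0; the hypothesis `c ≤ v` covers this default.
  +-maxℚ-least : ∀ {c v xs} → c ≤ v → (∀ {x} → x ∈ᴸ xs → c + x ≤ v) → c + maxℚ xs ≤ v
  +-maxℚ-least {c} {xs = []}     c≤v bound = ≤-trans (≤-reflexive (+-identityʳ c)) c≤v
  +-maxℚ-least {c} {v} {x ∷ xs} c≤v bound with ≤-total x (maxℚ xs)
  ... | inj₁ x≤ = subst (λ z → c + z ≤ v) (sym (p≤q⇒p⊔q≡q x≤)) (+-maxℚ-least c≤v (bound ∘ there))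
  ... | inj₂ ≤x = subst (λ z → c + z ≤ v) (sym (p≥q⇒p⊔q≡p ≤x)) (bound (here refl))

  nonempty⇒0<∣∣ : ∀ {n} {s : Fin n} {G} → s ∈ G → 0 ℕ.< ∣ G ∣
  nonempty⇒0<∣∣ {n} {G = G} s∈G = subst (ℕ._< ∣ G ∣) (∣⊥∣≡0 n) (p⊂q⇒∣p∣<∣q∣ (⊥⊆ , _ , s∈G , ∉⊥))

  module _ (I : Instance 2) where
    open Instance I

    +-costW-least : ∀ {G} (D : DecTree I G) {c v} → c ≤ v →
                    (∀ {s} → s ∈ G → c + cost I D s ≤ v) → c + costW I D ≤ v
    +-costW-least {G} D {c} {v} c≤v bound = +-maxℚ-least c≤v λ x∈ → let s , s∈ , eq = ∈-map⁻ (cost I D) x∈ in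
      subst (λ z → c + z ≤ v) (sym eq)
        (bound (proj₂ (∈-filter⁻ (λ s → s ∈? G) {xs = allFin n} s∈)))

    Split : Subset n → Fin k → Set
    Split G t = ∀ i → Nonempty (branch I G t i)

    split? : ∀ G t → Dec (Split G t)
    split? G t = Fin.all? λ i → nonempty? (branch I G t i)

    -- An equality rather than an inclusion, so that the only child of a test that does not split is
    -- a tree for `G` itself.
    branch-other : ∀ {G t i j} → i ≢ j → ¬ Nonempty (branch I G t i) → branch I G t j ≡ G
    branch-other i≢j empty = ⊆-antisym (branch-⊆ I)
      λ s∈G → ∈-branch⁺ I s∈G (Fin2-≢ i≢j λ o≡i → empty (_ , ∈-branch⁺ I s∈G o≡i))

    -- An empty branch would leave the other one equal to `G`, with all its pairs.
    P<⇒Split : ∀ {G t} → (∀ i → P I (branch I G t i) ℕ.< P I G) → Split G t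
    P<⇒Split {G} {t} P< i with nonempty? (branch I G t i) | other i
    ... | yes ne   | _       = ne
    ... | no empty | j , i≢j = contradiction (cong (P I) (branch-other i≢j empty)) (ℕ.<⇒≢ (P< j))

    Split⇒∣branch∣< : ∀ {G t} → Split G t → ∀ i → ∣ branch I G t i ∣ ℕ.< ∣ G ∣
    Split⇒∣branch∣< {G} {t} split i with other i
    ... | j , i≢j with split j
    ...   | s , s∈ = p⊂q⇒∣p∣<∣q∣ (branch-⊆ I , s , branch-⊆ I s∈ ,
      λ s∈ᵢ → i≢j (trans (sym (proj₂ (∈-branch⁻ I s∈ᵢ))) (proj₂ (∈-branch⁻ I s∈))))

    -- A test that does not split G only adds to the cost of the tree below it.
    module _ {G} (ne : Nonempty G) (¬hom : ¬ Homogeneous I G) {v : ℚ}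
             (v≤ : ∀ {t} ch → Split G t → v ≤ costW I (node {I = I} {G = G} ¬hom t ch)) where
      mutual
        split-suffices : ∀ {F} (D : DecTree I F) → F ≡ G → v ≤ costW I D
        split-suffices (leaf j class≡j) refl = contradiction (j , λ {s} → class≡j {s}) ¬hom
        split-suffices (node ¬h t ch)   refl with split? G t
        ... | yes split = v≤ ch split
        ... | no ¬split with Fin.¬∀⟶∃¬ 2 _ (λ i → nonempty? (branch I G t i)) ¬split
        ...   | i , empty with other i
        ...     | j , i≢j = split-suffices-child (ch j) (branch-other i≢j empty)
          (0≤costW I (node {I = I} {G = G} ¬h t ch)) λ {s} s∈ →
          ≤-trans (q≤p+q (0≤testCost I t j))
            (≤-trans (≤-reflexive (sym (cost-node I {¬hom = ¬h} {ch = ch} (proj₂ (∈-branch⁻ I s∈)))))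
                     (cost≤costW I (node {I = I} {G = G} ¬h t ch) (branch-⊆ I s∈)))

        -- `F` is a branch that equals `G` only propositionally, so the equation is an argument. The
        -- value `w` stands for the cost of the node above, to which this child is the only one that
        -- contributes objects.
        split-suffices-child : ∀ {F} (D : Child I F) → F ≡ G → ∀ {w} → 0ℚ ≤ w →
                               (∀ {s} → s ∈ F → childCost I D s ≤ w) → v ≤ w
        split-suffices-child (absent empty) refl 0≤w ≤w = contradiction ne empty
        split-suffices-child (present _ D)  F≡G  0≤w ≤w = ≤-trans (split-suffices D F≡G) (costW-least I D 0≤w ≤w)

    Optimal : ∀ {G} → DecTree I G → Set
    Optimal {G} D = ∀ D′ → costW I D ≤ costW I {G} D′

    module _ {G} (¬hom : ¬ Homogeneous I G)
             (optimal : ∀ {t} → Split G t → ∀ i → Σ[ D ∈ DecTree I (branch I G t i) ] Optimal D) where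
      splitTree : ∀ {t} → Split G t → DecTree I G
      splitTree {t} split = node ¬hom t λ i → present (split i) (proj₁ (optimal split i))

      splitTree-optimal : ∀ {t} ch (split : Split G t) →
                           costW I (splitTree split) ≤ costW I (node {I = I} {G = G} ¬hom t ch)
      splitTree-optimal {t} ch split = costW-least I (splitTree split) (0≤costW I D′) λ {s} s∈G →
        let i = outcome t s in
        ≤-trans (+-monoʳ-≤ (testCost t i) (cost≤costW I (proj₁ (optimal split i)) (∈-branch⁺ I s∈G refl)))
                (child-optimal i (ch i) refl)
        where
        D′ = node {I = I} {G = G} ¬hom t ch
        -- The child is a variable `c` with an equation, so that it can be matched while `D′` keeps
        -- referring to `ch`.
        child-optimal : ∀ i (c : Child I (branch I G t i)) → ch i ≡ c →
                        testCost t i + costW I (proj₁ (optimal split i)) ≤ costW I D′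
        child-optimal i (absent empty) eq = contradiction (split i) empty
        child-optimal i (present _ D)  eq = ≤-trans (+-monoʳ-≤ (testCost t i) (proj₂ (optimal split i) D))
          (+-costW-least D {c = testCost t i}
            (let s , s∈ = split i
                 s∈G , o≡i = ∈-branch⁻ I s∈
             in ≤-trans (p≤p+q (0≤cost I D s)) (bound s∈G o≡i))
            (λ s∈ → let s∈G , o≡i = ∈-branch⁻ I s∈ in bound s∈G o≡i))
          where
          bound : ∀ {s} → s ∈ G → outcome t s ≡ i → testCost t i + cost I D s ≤ costW I D′
          bound {s} s∈G o≡i = ≤-trans
            (≤-reflexive (sym (trans (cost-node I {¬hom = ¬hom} {ch = ch} o≡i)
              (cong (λ c → testCost t i + childCost I c s) eq))))
            (cost≤costW I D′ s∈G)

      optimal-node : Nonempty G → Σ[ D ∈ DecTree I G ] Optimal D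
      optimal-node ne with ∃progress I ne ¬hom
      ... | t₀ , P< = best , λ D′ → split-suffices ne ¬hom best≤ D′ refl
        where
        D₀ : DecTree I G
        D₀ = splitTree (P<⇒Split P<)
        candidate : ∀ t → Dec (Split G t) → DecTree I G
        candidate t (yes split) = splitTree split
        -- The default `D₀`, which exists by completeness, lets every test index a candidate.
        candidate t (no _)      = D₀
        candidates : List (DecTree I G)
        candidates = tabulate λ t → candidate t (split? G t)
        best : DecTree I G
        best = argmin (costW I) D₀ candidates
        best≤candidate : ∀ t → costW I best ≤ costW I (candidate t (split? G t))
        best≤candidate t = All.lookup (f[argmin]≤f[xs] {f = costW I} D₀ candidates) (∈-tabulate⁺ t)
        ≤candidate⇒≤ : ∀ {t v} ch (split : Dec (Split G t)) → v ≤ costW I (candidate t split) → Split G t →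
                       v ≤ costW I (node {I = I} {G = G} ¬hom t ch)
        ≤candidate⇒≤ ch (yes split) v≤ _     = ≤-trans v≤ (splitTree-optimal ch split)
        ≤candidate⇒≤ ch (no ¬split) _  split = contradiction split ¬split
        best≤ : ∀ {t} ch → Split G t → costW I best ≤ costW I (node {I = I} {G = G} ¬hom t ch)
        best≤ {t} ch = ≤candidate⇒≤ ch (split? G t) (best≤candidate t)

    optimalTree : ∀ N {G} → ∣ G ∣ ℕ.≤ N → Nonempty G → Σ[ D ∈ DecTree I G ] Optimal D
    optimalTree N {G} ∣G∣≤N ne with P I G ℕ.≟ 0
    ... | yes P≡0 = let j , class≡j = P≡0⇒Homogeneous I ne P≡0 in
      leaf j (λ {s} → class≡j {s}) , λ D′ →
        costW-least I (leaf {I = I} {G = G} j class≡j) (0≤costW I D′) λ _ → 0≤costW I D′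
    optimalTree zero    {G} ∣G∣≤0 ne@(s , s∈G) | no P≢0 = contradiction ∣G∣≤0 (ℕ.<⇒≱ (nonempty⇒0<∣∣ s∈G))
    optimalTree (suc N) {G} ∣G∣≤N ne | no P≢0 = optimal-node (λ hom → P≢0 (Homogeneous⇒P≡0 I hom))
      (λ split i → optimalTree N (ℕ.≤-pred (ℕ.≤-trans (Split⇒∣branch∣< split i) ∣G∣≤N)) (split i)) ne

-- Bit lengths and the cost of evaluating expressions

module BoundedEvaluation where
  open import Data.Nat.Base
  open import Data.Nat.Properties
  open import Data.Nat.Logarithm
  open import Data.Nat.Tactic.RingSolver using (solve-∀)
  open import Data.Bool.Base using (true; false; if_then_else_; T)
  open import Data.Fin.Base using (Fin; zero; suc)
  open import Data.Fin.Patterns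
  open import Data.Vec.Base as Vec using (Vec; []; _∷_)
  open import Relation.Binary.PropositionalEquality

  ⌊log₂⌋≤ : ∀ k {x} → x < 2 ^ suc k → ⌊log₂ x ⌋ ≤ k
  ⌊log₂⌋≤ zero {x} x<2 = ⌊log₂⌋-mono-≤ (≤-pred x<2)
  ⌊log₂⌋≤ (suc k) {x} x<2^ = begin
    ⌊log₂ x ⌋                   ≤⟨ m≤n+m∸n ⌊log₂ x ⌋ 1 ⟩
    suc (⌊log₂ x ⌋ ∸ 1)         ≡⟨ cong suc (sym (⌊log₂⌊n/2⌋⌋≡⌊log₂n⌋∸1 x)) ⟩
    suc ⌊log₂ ⌊ x /2⌋ ⌋         ≤⟨ s≤s (⌊log₂⌋≤ k half<) ⟩
    suc k                       ∎
    where
    open ≤-Reasoning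
    half< : ⌊ x /2⌋ < 2 ^ suc k
    half< = *-cancelˡ-< 2 _ _ (≤-<-trans 2*half≤ x<2^)
      where
      2*half≤ : 2 * ⌊ x /2⌋ ≤ x
      2*half≤ = begin
        ⌊ x /2⌋ + (⌊ x /2⌋ + 0)   ≡⟨ cong (⌊ x /2⌋ +_) (+-identityʳ _) ⟩
        ⌊ x /2⌋ + ⌊ x /2⌋         ≤⟨ +-monoʳ-≤ ⌊ x /2⌋ (⌊n/2⌋≤⌈n/2⌉ x) ⟩
        ⌊ x /2⌋ + ⌈ x /2⌉         ≡⟨ ⌊n/2⌋+⌈n/2⌉≡n x ⟩
        x                         ∎

  <2^bitLength : ∀ x → x < 2 ^ bitLength x
  <2^bitLength x = go x ≤-refl
    where
    open ≤-Reasoning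
    go : ∀ {k} x → x ≤ k → x < 2 ^ bitLength x
    go {_}     0             _   = s≤s z≤n
    go {_}     1             _   = s≤s (s≤s z≤n)
    go {suc k} x@(suc (suc y)) x≤k = begin
      suc x                           ≡⟨ cong suc (sym (⌊n/2⌋+⌈n/2⌉≡n x)) ⟩
      suc h + ⌈ x /2⌉                 ≤⟨ +-monoʳ-≤ (suc h) (⌊n/2⌋-mono (n≤1+n (suc x))) ⟩
      suc h + suc h                   ≡⟨ cong (suc h +_) (sym (+-identityʳ (suc h))) ⟩
      2 * suc h                       ≤⟨ *-monoʳ-≤ 2 (go {k} h (≤-trans (s≤s (⌊n/2⌋≤n y)) (≤-pred x≤k))) ⟩
      2 ^ suc (suc ⌊log₂ h ⌋)         ≡⟨ cong (λ l → 2 ^ suc (suc l)) (⌊log₂⌊n/2⌋⌋≡⌊log₂n⌋∸1 x) ⟩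
      2 ^ suc (suc (⌊log₂ x ⌋ ∸ 1))   ≡⟨ cong (λ l → 2 ^ suc l) (m+[n∸m]≡n (⌊log₂⌋-mono-≤ {2} {x} (s≤s (s≤s z≤n)))) ⟩
      2 ^ bitLength x                 ∎
      where
      h = ⌊ x /2⌋

  bitLength-mono : ∀ {x y} → x ≤ y → bitLength x ≤ bitLength y
  bitLength-mono x≤y = s≤s (⌊log₂⌋-mono-≤ x≤y)

  bitLength-* : ∀ x y → bitLength (x * y) ≤ bitLength x + bitLength y
  bitLength-* x y = s≤s (⌊log₂⌋≤ (⌊log₂ x ⌋ + bitLength y) (begin-strict
    x * y                               ≤⟨ *-monoʳ-≤ x (<⇒≤ (<2^bitLength y)) ⟩
    x * 2 ^ bitLength y                 <⟨ *-monoˡ-< (2 ^ bitLength y) {{m^n≢0 2 (bitLength y)}} (<2^bitLength x) ⟩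
    2 ^ bitLength x * 2 ^ bitLength y   ≡⟨ sym (^-distribˡ-+-* 2 (bitLength x) (bitLength y)) ⟩
    2 ^ suc (⌊log₂ x ⌋ + bitLength y)   ∎))
    where open ≤-Reasoning

  bitLength≤suc : ∀ x → bitLength x ≤ suc x
  bitLength≤suc x = s≤s (⌊log₂⌋≤ x (n<2^suc x))
    where
    n<2^suc : ∀ n → n < 2 ^ suc n
    n<2^suc zero    = s≤s z≤n
    n<2^suc (suc n) = +-mono-≤ (≤-trans (s≤s z≤n) (n<2^suc n)) (≤-trans (n<2^suc n) (≤-reflexive (sym (+-identityʳ _))))

  bitLength≤ : ∀ {x w} → x ≤ w → bitLength x ≤ suc w
  bitLength≤ {x} x≤w = ≤-trans (bitLength≤suc x) (s≤s x≤w)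

  bitLength-bit : ∀ {x w} → x ≤ 1 → bitLength x ≤ suc w
  bitLength-bit {x} x≤1 = ≤-trans (bitLength-mono x≤1) (s≤s z≤n)

  -- Costs are bounded by k · suc w + a · r + b · r′, where suc w is a unit that
  -- dominates the bit lengths of all operands and r and r′ are the costs of the
  -- recursive calls. The coefficients are closed numerals computed by unification.
  module Bounded (A : Program) where
    open Program A

    record Runs (g : Fin functions) (ρ : Vec Value (arity g)) (v : Value) (t : ℕ) : Set where
      constructor runs
      field
        {steps} : ℕ
        run     : _⊢_⇓_[_] A ρ (body g) v steps
        bound   : steps ≤ t

    Runs-≤ : ∀ {g ρ v t t′} → t ≤ t′ → Runs g ρ v t → Runs g ρ v t′
    Runs-≤ t≤t′ (runs r b) = runs r (≤-trans b t≤t′)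

    module _ {w r r′ : ℕ} where
      cost-bound : ℕ → ℕ → ℕ → ℕ
      cost-bound k a b = k * suc w + (a * r + b * r′)

      record Ev {Γ} (ρ : Vec Value Γ) (e : Expr arity Γ) (v : Value) (k a b : ℕ) : Set where
        constructor ev
        field
          {steps} : ℕ
          run     : _⊢_⇓_[_] A ρ e v steps
          bound   : steps ≤ cost-bound k a b

      record Ev* {Γ l} (ρ : Vec Value Γ) (es : Vec (Expr arity Γ) l) (vs : Vec Value l) (k a b : ℕ) : Set where
        constructor ev
        field
          {steps} : ℕ
          run     : _⊢*_⇓_[_] A ρ es vs steps
          bound   : steps ≤ cost-bound k a b

      cost-bound-+ : ∀ {c c′} j k a b k′ a′ b′ → c ≤ cost-bound k a b → c′ ≤ cost-bound k′ a′ b′ →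
                     j + (c + c′) ≤ cost-bound (j + (k + k′)) (a + a′) (b + b′)
      cost-bound-+ j k a b k′ a′ b′ c≤ c′≤ = ≤-trans
        (+-mono-≤ (m≤m*n j (suc w)) (+-mono-≤ c≤ c′≤)) (≤-reflexive (collect j k a b k′ a′ b′ (suc w) r r′))
        where
        collect : ∀ j k a b k′ a′ b′ u r r′ →
          j * u + (k * u + (a * r + b * r′) + (k′ * u + (a′ * r + b′ * r′))) ≡
          (j + (k + k′)) * u + ((a + a′) * r + (b + b′) * r′)
        collect = solve-∀

      cost-bound-mono : ∀ {k k′ a a′ b b′} → k ≤ k′ → a ≤ a′ → b ≤ b′ → cost-bound k a b ≤ cost-bound k′ a′ b′
      cost-bound-mono k≤ a≤ b≤ = +-mono-≤ (*-monoˡ-≤ (suc w) k≤) (+-mono-≤ (*-monoˡ-≤ r a≤) (*-monoˡ-≤ r′ b≤))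

      module _ {Γ} {ρ : Vec Value Γ} where
        evVar : ∀ {x} → Ev ρ (var x) (Vec.lookup ρ x) 1 0 0
        evVar = ev var (cost-bound-+ 1 0 0 0 0 0 0 z≤n z≤n)

        evLit : ∀ {x} → Ev ρ (lit x) (nat x) 1 0 0
        evLit = ev lit (cost-bound-+ 1 0 0 0 0 0 0 z≤n z≤n)

        -- The 3 units are one for the step and one for the length of each operand.
        evOp : ∀ {o e e′ x y k a b k′ a′ b′} → Ev ρ e (nat x) k a b → Ev ρ e′ (nat y) k′ a′ b′ →
               bitLength x ≤ suc w → bitLength y ≤ suc w →
               Ev ρ (op o e e′) (nat (⟦ o ⟧ x y)) (3 + (k + k′)) (a + a′) (b + b′)
        evOp {k = k} {a} {b} {k′} {a′} {b′} (ev {c} d c≤) (ev {c′} d′ c′≤) x≤ y≤ = ev (op d d′)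
          (≤-trans (≤-reflexive (cong suc (+-comm (c + c′) _)))
          (≤-trans (s≤s (+-mono-≤ (+-mono-≤ x≤ y≤) (cost-bound-+ 0 k a b k′ a′ b′ c≤ c′≤)))
          (≤-trans (+-monoˡ-≤ (suc w + suc w + cost-bound (k + k′) (a + a′) (b + b′)) (m≤m*n 1 (suc w)))
            (≤-reflexive (collect (suc w) (k + k′) _)))))
          where
          collect : ∀ u k z → 1 * u + (u + u + (k * u + z)) ≡ (3 + k) * u + z
          collect = solve-∀

        evPair : ∀ {e e′ v v′ k a b k′ a′ b′} → Ev ρ e v k a b → Ev ρ e′ v′ k′ a′ b′ →
                 Ev ρ (pair e e′) (pair v v′) (1 + (k + k′)) (a + a′) (b + b′)
        evPair {k = k} {a} {b} {k′} {a′} {b′} (ev d c≤) (ev d′ c′≤) =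
          ev (pair d d′) (cost-bound-+ 1 k a b k′ a′ b′ c≤ c′≤)

        evLet : ∀ {e e′ v v′ k a b k′ a′ b′} → Ev ρ e v k a b → Ev (v ∷ ρ) e′ v′ k′ a′ b′ →
                Ev ρ (let′ e e′) v′ (1 + (k + k′)) (a + a′) (b + b′)
        evLet {k = k} {a} {b} {k′} {a′} {b′} (ev d c≤) (ev d′ c′≤) =
          ev (let′ d d′) (cost-bound-+ 1 k a b k′ a′ b′ c≤ c′≤)

        evZero : ∀ {e e₁ e₂ v k a b k′ a′ b′} → Ev ρ e (nat 0) k a b → Ev ρ e₁ v k′ a′ b′ →
                 Ev ρ (ifz e e₁ e₂) v (1 + (k + k′)) (a + a′) (b + b′)
        evZero {k = k} {a} {b} {k′} {a′} {b′} (ev d c≤) (ev d′ c′≤) =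
          ev (ifz-zero d d′) (cost-bound-+ 1 k a b k′ a′ b′ c≤ c′≤)

        evSuc : ∀ {e e₁ e₂ x v k a b k′ a′ b′} → Ev ρ e (nat (suc x)) k a b → Ev ρ e₂ v k′ a′ b′ →
                Ev ρ (ifz e e₁ e₂) v (1 + (k + k′)) (a + a′) (b + b′)
        evSuc {k = k} {a} {b} {k′} {a′} {b′} (ev d c≤) (ev d′ c′≤) =
          ev (ifz-suc d d′) (cost-bound-+ 1 k a b k′ a′ b′ c≤ c′≤)

        evNat : ∀ {e e₁ e₂ x v k a b k′ a′ b′} → Ev ρ e (nat x) k a b → Ev (nat x ∷ ρ) e₁ v k′ a′ b′ →
                Ev ρ (case e e₁ e₂) v (1 + (k + k′)) (a + a′) (b + b′)
        evNat {k = k} {a} {b} {k′} {a′} {b′} (ev d c≤) (ev d′ c′≤) =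
          ev (case-nat d d′) (cost-bound-+ 1 k a b k′ a′ b′ c≤ c′≤)

        evCase : ∀ {e e₁ e₂ v₁ v₂ v k a b k′ a′ b′} → Ev ρ e (pair v₁ v₂) k a b → Ev (v₁ ∷ v₂ ∷ ρ) e₂ v k′ a′ b′ →
                 Ev ρ (case e e₁ e₂) v (1 + (k + k′)) (a + a′) (b + b′)
        evCase {k = k} {a} {b} {k′} {a′} {b′} (ev d c≤) (ev d′ c′≤) =
          ev (case-pair d d′) (cost-bound-+ 1 k a b k′ a′ b′ c≤ c′≤)

        evWeaken : ∀ {e v k a b k′ a′ b′} → k ≤ k′ → a ≤ a′ → b ≤ b′ → Ev ρ e v k a b → Ev ρ e v k′ a′ b′
        evWeaken k≤ a≤ b≤ (ev d c≤) = ev d (≤-trans c≤ (cost-bound-mono k≤ a≤ b≤))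

        -- The coefficients of both branches are added, which spares taking maxima.
        evIf : ∀ {e e₁ e₂ v₁ v₂ k a b k₁ a₁ b₁ k₂ a₂ b₂} c → Ev ρ e (nat (if c then 1 else 0)) k a b →
               Ev ρ e₁ v₁ k₁ a₁ b₁ → Ev ρ e₂ v₂ k₂ a₂ b₂ →
               Ev ρ (ifz e e₁ e₂) (if c then v₂ else v₁) (1 + (k + (k₁ + k₂))) (a + (a₁ + a₂)) (b + (b₁ + b₂))
        evIf false d d₁ d₂ = evZero d (evWeaken (m≤m+n _ _) (m≤m+n _ _) (m≤m+n _ _) d₁)
        evIf {k₁ = k₁} {a₁} {b₁} true  d d₁ d₂ = evSuc d (evWeaken (m≤n+m _ k₁) (m≤n+m _ a₁) (m≤n+m _ b₁) d₂)

        []ᵉ : Ev* ρ [] [] 0 0 0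
        []ᵉ = ev [] z≤n

        infixr 5 _∷ᵉ_

        _∷ᵉ_ : ∀ {l e v k a b k′ a′ b′} {es : Vec (Expr arity Γ) l} {vs} → Ev ρ e v k a b → Ev* ρ es vs k′ a′ b′ →
               Ev* ρ (e ∷ es) (v ∷ vs) (k + k′) (a + a′) (b + b′)
        _∷ᵉ_ {k = k} {a} {b} {k′} {a′} {b′} (ev d c≤) (ev ds c′≤) = ev (d ∷ ds) (cost-bound-+ 0 k a b k′ a′ b′ c≤ c′≤)

        evCall-bound : ∀ {g es vs v t k a b} k′ a′ b′ → t ≤ cost-bound k′ a′ b′ → Ev* ρ es vs k a b → Runs g vs v t →
                       Ev ρ (call g es) v (1 + (k + k′)) (a + a′) (b + b′)
        evCall-bound {k = k} {a} {b} k′ a′ b′ t≤ (ev ds c≤) (runs d c′≤) =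
          ev (call ds d) (cost-bound-+ 1 k a b k′ a′ b′ c≤ (≤-trans c′≤ t≤))

        evCall : ∀ {g es vs v k a b k′} → Ev* ρ es vs k a b → Runs g vs v (k′ * suc w) →
                 Ev ρ (call g es) v (1 + (k + k′)) (a + 0) (b + 0)
        evCall {k′ = k′} = evCall-bound k′ 0 0 (≤-reflexive (sym (+-identityʳ _)))

        -- `r` and `r′` are kept apart because `buildᶠ` calls itself on two branches of unrelated
        -- cost; the list functions use `r` alone.
        evRec : ∀ {g es vs v k a b} → Ev* ρ es vs k a b → Runs g vs v r →
                Ev ρ (call g es) v (1 + (k + 0)) (a + 1) (b + 0)
        evRec = evCall-bound 0 1 0 (≤-reflexive (sym (trans (+-identityʳ _) (*-identityˡ r))))

        evRec′ : ∀ {g es vs v k a b} → Ev* ρ es vs k a b → Runs g vs v r′ →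
                 Ev ρ (call g es) v (1 + (k + 0)) (a + 0) (b + 1)
        evRec′ = evCall-bound 0 0 1 (≤-reflexive (sym (*-identityˡ r′)))

        evValue : ∀ {e v v′ k a b} → v ≡ v′ → Ev ρ e v k a b → Ev ρ e v′ k a b
        evValue refl d = d

    -- The budgets `K` are generous round numbers. That the coefficients collected from a body stay
    -- below them, and that each kind of recursive call is counted at most once, is settled by
    -- evaluating the Boolean tests.
    close : ∀ {g} {ρ : Vec Value (arity g)} {v k a b} K w r r′ → Ev {w} {r} {r′} ρ (body g) v k a b →
            {T (k ≤ᵇ K)} → {T (a ≤ᵇ 1)} → {T (b ≤ᵇ 1)} → Runs g ρ v (K * suc w + (r′ + r))
    close {k = k} {a} {b} K w r r′ (ev d c≤) {k≤} {a≤} {b≤} = runs d (≤-trans c≤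
      (≤-trans (cost-bound-mono {w} {r} {r′} (≤ᵇ⇒≤ k K k≤) (≤ᵇ⇒≤ a 1 a≤) (≤ᵇ⇒≤ b 1 b≤))
        (≤-reflexive (cong (K * suc w +_) (trans (cong₂ _+_ (*-identityˡ r) (*-identityˡ r′)) (+-comm r r′))))))

  -- The program

  pattern onesᶠ     = 0F
  pattern restrictᶠ = 1F
  pattern countᶠ    = 2F
  pattern pairsᶠ    = 3F
  pattern labelᶠ    = 4F
  pattern fractionᶠ = 5F
  pattern compareᶠ  = 6F
  pattern ratioᶠ    = 7F
  pattern selectᶠ   = 8F
  pattern buildᶠ    = 9F

  arities : Fin 10 → ℕ
  arities onesᶠ     = 1
  arities restrictᶠ = 3
  arities countᶠ    = 3
  arities pairsᶠ    = 2
  arities labelᶠ    = 2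
  arities fractionᶠ = 6
  arities compareᶠ  = 2
  arities ratioᶠ    = 4
  arities selectᶠ   = 4
  arities buildᶠ    = 3

  -- Fills the branches of `case` that a run on an encoded instance never enters.
  dead : ∀ {Γ} → Expr arities Γ
  dead = lit 0

  -- The arguments are listed above each body. Subsets are lists of bits. A fraction with denominator 0 stands for +∞.
  bodies : (g : Fin 10) → Expr arities (arities g)
  -- classes
  bodies onesᶠ = case (var 0F) (lit 0) (pair (lit 1) (call onesᶠ (var 1F ∷ [])))
  -- i, G, outcomes
  bodies restrictᶠ = case (var 1F) (lit 0) (case (var 4F) dead
    -- The bit of an object in the branch: truncated subtraction of its outcome selects outcome 0,
    -- multiplication by it selects outcome 1.
    (pair (ifz (var 4F) (op sub (var 2F) (var 0F)) (op mul (var 2F) (var 0F)))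
          (call restrictᶠ (var 4F ∷ var 3F ∷ var 1F ∷ []))))
  -- c, G, classes
  bodies countᶠ = case (var 1F) (lit 0) (case (var 4F) dead
    -- Two classes are equal when they compare both ways, so the subtracted product is the indicator
    -- of equality.
    (op add (op mul (var 2F) (op sub (lit 1) (op mul (op leq (var 4F) (var 0F)) (op leq (var 0F) (var 4F)))))
            (call countᶠ (var 4F ∷ var 3F ∷ var 1F ∷ []))))
  -- G, classes
  bodies pairsᶠ = case (var 0F) (lit 0) (case (var 3F) dead
    (op add (op mul (var 2F) (call countᶠ (var 0F ∷ var 3F ∷ var 1F ∷ [])))
            (call pairsᶠ (var 3F ∷ var 1F ∷ []))))
  -- G, classes
  bodies labelᶠ = case (var 0F) dead (case (var 3F) dead
    (ifz (var 2F) (call labelᶠ (var 3F ∷ var 1F ∷ [])) (var 0F)))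
  -- i, P(G), G, classes, outcomes, cost
  bodies fractionᶠ = case (var 5F) dead
    (pair (var 0F) (op mul (var 1F) (op sub (var 3F)
      (call pairsᶠ (call restrictᶠ (var 2F ∷ var 4F ∷ var 6F ∷ []) ∷ var 5F ∷ [])))))
  bodies compareᶠ = case (var 0F) dead (case (var 3F) dead
    (op leq (op mul (var 2F) (var 1F)) (op mul (var 0F) (var 3F))))
  -- P(G), G, classes, test
  bodies ratioᶠ = case (var 3F) dead (case (var 1F) dead (case (var 1F) dead
    (let′ (call fractionᶠ (lit 0 ∷ var 6F ∷ var 7F ∷ var 8F ∷ var 4F ∷ var 2F ∷ []))
    (let′ (call fractionᶠ (lit 1 ∷ var 7F ∷ var 8F ∷ var 9F ∷ var 5F ∷ var 1F ∷ []))
      (ifz (call compareᶠ (var 1F ∷ var 0F ∷ [])) (var 1F) (var 0F))))))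
  -- P(G), G, classes, tests; returns index, test and ratio of the best test
  bodies selectᶠ = case (var 3F) (pair (lit 0) (pair (lit 0) (pair (lit 1) (lit 0))))
    (let′ (call ratioᶠ (var 2F ∷ var 3F ∷ var 4F ∷ var 0F ∷ []))
    (let′ (call selectᶠ (var 3F ∷ var 4F ∷ var 5F ∷ var 2F ∷ []))
    (case (var 0F) dead (case (var 1F) dead
      (ifz (call compareᶠ (var 5F ∷ var 1F ∷ []))
        (pair (op add (var 2F) (lit 1)) (var 3F))
        (pair (lit 0) (pair (var 6F) (var 5F))))))))
  -- G, classes, tests
  bodies buildᶠ = let′ (call pairsᶠ (var 0F ∷ var 1F ∷ []))
    (ifz (var 0F) (call labelᶠ (var 1F ∷ var 2F ∷ []))
      (case (call selectᶠ (var 0F ∷ var 1F ∷ var 2F ∷ var 3F ∷ [])) dead (case (var 1F) dead (case (var 0F) dead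
        (pair (var 4F)
          -- A child is written as a singleton list. Greedy tests split their set, so the encoding
          -- of an absent child is never produced.
          (pair (pair (call buildᶠ (call restrictᶠ (lit 0 ∷ var 7F ∷ var 0F ∷ []) ∷ var 8F ∷ var 9F ∷ [])) (lit 0))
          (pair (pair (call buildᶠ (call restrictᶠ (lit 1 ∷ var 7F ∷ var 0F ∷ []) ∷ var 8F ∷ var 9F ∷ [])) (lit 0))
                (lit 0))))))))

  dividePairs : Program
  dividePairs = record
    { arity = arities
    ; body = bodies
    ; main = case (var 0F) dead (case (var 1F) dead
        (call buildᶠ (call onesᶠ (var 2F ∷ []) ∷ var 2F ∷ var 1F ∷ [])))
    }

-- Correctness and cost of the list functions

module ListPrograms where
  open SeparatedPairs
  open BoundedEvaluation
  open import Data.Nat.Base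
  open import Data.Nat.Properties
  open import Data.Nat.Tactic.RingSolver using (solve-∀)
  open import Data.Bool.Base using (true; false; _∧_; T)
  open import Data.Fin.Base using (Fin; zero; suc; toℕ)
  import Data.Fin.Properties as Fin
  open import Data.Fin.Patterns
  open import Data.Fin.Subset using (Subset; _∈_; _∩_; ⊤; Nonempty)
  open import Data.Vec.Base as Vec using (Vec; []; _∷_; here; there)
  open import Data.List.Base using (tabulate)
  open import Data.Product.Base using (_,_)
  open import Data.Sum.Base using (inj₁; inj₂)
  open import Function.Base using (_∘_)
  open import Relation.Binary.PropositionalEquality
  open import Relation.Nullary using (yes; no; does; contradiction)

  open Bounded dividePairs

  encBits : ∀ {n} → Subset n → Value
  encBits []      = nat 0
  encBits (g ∷ G) = pair (nat (indicator g)) (encBits G)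

  encFins : ∀ {n m} → (Fin n → Fin m) → Value
  encFins f = encList (tabulate (λ s → encFin (f s)))

  toℕ≤1 : (i : Fin 2) → toℕ i ≤ 1
  toℕ≤1 = Fin.toℕ≤pred[n]

  ones-runs : ∀ {n m} w (cl : Fin n → Fin m) → Runs onesᶠ (encFins cl ∷ [])
    (encBits (⊤ {n})) (suc n * (10 * suc w))
  ones-runs {zero}  w cl = close 10 w 0 0 (evNat evVar evLit)
  ones-runs {suc n} w cl = close 10 w (suc n * (10 * suc w)) 0
    (evCase evVar (evPair evLit (evRec (evVar ∷ᵉ []ᵉ) (ones-runs w (cl ∘ suc)))))

  restrict-runs : ∀ {n} w i (G : Subset n) (f : Fin n → Fin 2) →
    Runs restrictᶠ (encFin i ∷ encBits G ∷ encFins f ∷ [])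
      (encBits (G ∩ Vec.tabulate (λ s → does (f s Fin.≟ i)))) (suc n * (20 * suc w))
  restrict-runs w i [] f = close 20 w 0 0 (evNat evVar evLit)
  restrict-runs {suc n} w 0F (g ∷ G) f = close 20 w (suc n * (20 * suc w)) 0
    (evCase evVar (evCase evVar (evPair
      (evZero evVar (evValue (cong nat (bit g (f zero)))
        (evOp evVar evVar (bitLength-bit (indicator≤1 g)) (bitLength-bit (toℕ≤1 (f zero))))))
      (evRec (evVar ∷ᵉ evVar ∷ᵉ evVar ∷ᵉ []ᵉ) (restrict-runs w 0F G (f ∘ suc))))))
    where
    bit : ∀ g (o : Fin 2) → indicator g ∸ toℕ o ≡ indicator (g ∧ does (o Fin.≟ 0F))
    bit true  0F = refl
    bit true  1F = refl
    bit false 0F = refl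
    bit false 1F = refl
  restrict-runs {suc n} w 1F (g ∷ G) f = close 20 w (suc n * (20 * suc w)) 0
    (evCase evVar (evCase evVar (evPair
      (evSuc evVar (evValue (cong nat (bit g (f zero)))
        (evOp evVar evVar (bitLength-bit (indicator≤1 g)) (bitLength-bit (toℕ≤1 (f zero))))))
      (evRec (evVar ∷ᵉ evVar ∷ᵉ evVar ∷ᵉ []ᵉ) (restrict-runs w 1F G (f ∘ suc))))))
    where
    bit : ∀ g (o : Fin 2) → indicator g * toℕ o ≡ indicator (g ∧ does (o Fin.≟ 1F))
    bit true  0F = refl
    bit true  1F = refl
    bit false 0F = refl
    bit false 1F = refl

  label-runs : ∀ {n m} w (G : Subset n) (cl : Fin n → Fin m) {j} → Nonempty G → (∀ {s} → s ∈ G → cl s ≡ j) →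
    Runs labelᶠ (encBits G ∷ encFins cl ∷ []) (encFin j) (suc n * (20 * suc w))
  label-runs w [] cl (_ , ()) _
  label-runs {suc n} w (true ∷ G) cl ne cl≡j = close 20 w (suc n * (20 * suc w)) 0
    (evWeaken {k′ = 20} {a′ = 1} {b′ = 1} (≤ᵇ⇒≤ 7 20 _) z≤n z≤n
      (evCase evVar (evCase evVar (evSuc evVar (evValue (cong encFin (cl≡j here)) evVar)))))
  label-runs {suc n} w (false ∷ G) cl (suc s , there s∈G) cl≡j = close 20 w (suc n * (20 * suc w)) 0
    (evCase evVar (evCase evVar (evZero evVar
      (evRec (evVar ∷ᵉ evVar ∷ᵉ []ᵉ) (label-runs w G (cl ∘ suc) (s , s∈G) (cl≡j ∘ there))))))

  leq-true : ∀ {x y} → x ≤ y → ⟦ leq ⟧ x y ≡ 1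
  leq-true {x} {y} x≤y with x ≤ᵇ y | ≤⇒≤ᵇ x≤y
  ... | true | _ = refl

  leq-false : ∀ {x y} → y < x → ⟦ leq ⟧ x y ≡ 0
  leq-false {x} {y} y<x with x ≤ᵇ y in eq
  ... | false = refl
  ... | true  = contradiction (≤ᵇ⇒≤ x y (subst T (sym eq) _)) (<⇒≱ y<x)

  leq≤1 : ∀ x y → ⟦ leq ⟧ x y ≤ 1
  leq≤1 x y with x ≤ᵇ y
  ... | true  = ≤-refl
  ... | false = z≤n

  differ-leq : ∀ {m} (c d : Fin m) →
               1 ∸ (⟦ leq ⟧ (toℕ c) (toℕ d) * ⟦ leq ⟧ (toℕ d) (toℕ c)) ≡ indicator (differ c d)
  differ-leq c d with c Fin.≟ d
  ... | yes refl rewrite leq-true (≤-refl {toℕ c}) = refl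
  ... | no c≢d with ≤-<-connex (toℕ c) (toℕ d)
  ...   | inj₂ d<c rewrite leq-false d<c = refl
  ...   | inj₁ c≤d rewrite leq-false (≤∧≢⇒< c≤d (c≢d ∘ Fin.toℕ-injective))
          | *-zeroʳ (⟦ leq ⟧ (toℕ c) (toℕ d)) = refl

  count-runs : ∀ {n m} w c (G : Subset n) (cl : Fin n → Fin m) →
    bitLength (toℕ c) ≤ suc w → (∀ s → bitLength (toℕ (cl s)) ≤ suc w) → n ≤ w →
    Runs countᶠ (encFin c ∷ encBits G ∷ encFins cl ∷ []) (nat (countDiffering c G cl)) (suc n * (40 * suc w))
  count-runs w c [] cl c≤ cl≤ n≤w = close 40 w 0 0 (evNat evVar evLit)
  count-runs {suc n} w c (g ∷ G) cl c≤ cl≤ n<w = close 40 w (suc n * (40 * suc w)) 0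
    (evValue (cong (λ z → nat (indicator g * z + countDiffering c G (cl ∘ suc))) (differ-leq c (cl zero)))
      (evCase evVar (evCase evVar (evOp
        (evOp evVar (evOp evLit (evOp (evOp evVar evVar c≤ (cl≤ zero)) (evOp evVar evVar (cl≤ zero) c≤)
            (bitLength-bit (leq≤1 (toℕ c) (toℕ (cl zero)))) (bitLength-bit (leq≤1 (toℕ (cl zero)) (toℕ c))))
            (bitLength-bit ≤-refl) (bitLength-bit ll≤1))
          (bitLength-bit (indicator≤1 g)) (bitLength-bit (m∸n≤m 1 ll)))
        (evRec (evVar ∷ᵉ evVar ∷ᵉ evVar ∷ᵉ []ᵉ) (count-runs w c G (cl ∘ suc) c≤ (cl≤ ∘ suc) (<⇒≤ n<w)))
        (bitLength-bit (*-mono-≤ (indicator≤1 g) (m∸n≤m 1 ll)))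
        (bitLength≤ (≤-trans (countDiffering-≤ c G (cl ∘ suc)) (<⇒≤ n<w)))))))
    where
    ll = ⟦ leq ⟧ (toℕ c) (toℕ (cl zero)) * ⟦ leq ⟧ (toℕ (cl zero)) (toℕ c)
    ll≤1 : ll ≤ 1
    ll≤1 = *-mono-≤ (leq≤1 (toℕ c) (toℕ (cl zero))) (leq≤1 (toℕ (cl zero)) (toℕ c))

  -- suc (raise N w) = suc N * suc w is the unit for a step that traverses a list
  -- of length at most N.
  raise : ℕ → ℕ → ℕ
  raise N w = w + N * suc w

  traverse-≤ : ∀ {n N} K w → n ≤ N → suc n * (K * suc w) ≤ K * suc (raise N w)
  traverse-≤ {n} {N} K w n≤N = ≤-trans (*-monoˡ-≤ (K * suc w) (s≤s n≤N)) (≤-reflexive (swap (suc N) K (suc w)))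
    where
    swap : ∀ N K u → N * (K * u) ≡ K * (N * u)
    swap = solve-∀

  w≤raise : ∀ N w → w ≤ raise N w
  w≤raise N w = m≤m+n w _

  -- In the raised unit a whole traversal counts as `K` steps, so the budget of a caller is again a
  -- closed numeral whatever the length of the list.
  evTraverse : ∀ {N w r r′ g Γ} {ρ : Vec Value Γ} {es vs v k a b} K {n} → n ≤ N →
    Ev* {raise N w} {r} {r′} {Γ} {arities g} ρ es vs k a b → Runs g vs v (suc n * (K * suc w)) →
    Ev {raise N w} {r} {r′} ρ (call g es) v (1 + (k + K)) (a + 0) (b + 0)
  evTraverse {w = w} K n≤N args run = evCall {k′ = K} args (Runs-≤ (traverse-≤ K w n≤N) run)

  module _ (N w : ℕ) (N²≤w : N * N ≤ w) where
    N≤w : N ≤ w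
    N≤w = ≤-trans (m≤m*m N) N²≤w
      where
      m≤m*m : ∀ m → m ≤ m * m
      m≤m*m zero    = z≤n
      m≤m*m (suc m) = m≤m*n (suc m) (suc m)

    countPairs-≤ : ∀ {n m} (G : Subset n) (cl : Fin n → Fin m) → n ≤ N → countPairs G cl ≤ w
    countPairs-≤ {n} G cl n≤N = ≤-trans (m≤m+n _ _) (≤-trans (m≤m+n _ n)
      (≤-trans (2*countPairs+n≤n² G cl) (≤-trans (*-mono-≤ n≤N n≤N) N²≤w)))

    -- Each step starts a traversal by `countᶠ`, so the unit of this outer traversal is raised once;
    -- the counts themselves are at most `N * N` and fit the original unit.
    pairs-runs : ∀ {n m} (G : Subset n) (cl : Fin n → Fin m) → (∀ s → bitLength (toℕ (cl s)) ≤ suc w) → n ≤ N →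
      Runs pairsᶠ (encBits G ∷ encFins cl ∷ []) (nat (countPairs G cl)) (suc n * (60 * suc (raise N w)))
    pairs-runs [] cl cl≤ n≤N = close 60 (raise N w) 0 0 (evNat evVar evLit)
    pairs-runs {suc n} (g ∷ G) cl cl≤ n<N = close 60 (raise N w) (suc n * (60 * suc (raise N w))) 0
      (evCase evVar (evCase evVar (evOp
        (evOp evVar (evTraverse 40 n≤N (evVar ∷ᵉ evVar ∷ᵉ evVar ∷ᵉ []ᵉ)
            (count-runs w (cl zero) G (cl ∘ suc) (cl≤ zero) (cl≤ ∘ suc) (≤-trans n≤N N≤w)))
          (bitLength-bit (indicator≤1 g)) (bitLength≤ count≤))
        (evRec (evVar ∷ᵉ evVar ∷ᵉ []ᵉ) (pairs-runs G (cl ∘ suc) (cl≤ ∘ suc) n≤N))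
        (bitLength≤ (≤-trans (*-monoˡ-≤ (countDiffering (cl zero) G (cl ∘ suc)) (indicator≤1 g))
          (≤-trans (≤-reflexive (*-identityˡ _)) count≤)))
        (bitLength≤ (≤-trans (countPairs-≤ G (cl ∘ suc) n≤N) (w≤raise N w))))))
      where
      n≤N : n ≤ N
      n≤N = <⇒≤ n<N
      count≤ : countDiffering (cl zero) G (cl ∘ suc) ≤ raise N w
      count≤ = ≤-trans (countDiffering-≤ (cl zero) G (cl ∘ suc)) (≤-trans n≤N (≤-trans N≤w (w≤raise N w)))

-- The program computes a greedy tree

module Implementation where
  open Rationals hiding (*-mono-≤)
  open SeparatedPairs
  open Approximation hiding (opt)
  open Optimum
  open BoundedEvaluation
  open ListPrograms
  open import Data.Nat.Base hiding (∣_-_∣)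
  open import Data.Nat.Properties
  open import Data.Nat.Tactic.RingSolver using (solve-∀)
  open import Data.Integer.Base as ℤ using (+_; +[1+_]; +0; -[1+_]; ∣_∣)
  import Data.Integer.Properties as ℤ
  open import Data.Rational.Base as ℚ using (ℚ; 0ℚ; mkℚ; ↥_; ↧ₙ_)
  import Data.Rational.Properties as ℚ
  open import Data.Rational.Unnormalised.Base using (mkℚᵘ; *≡*)
  import Data.Rational.Unnormalised.Properties as ℚᵘ
  open import Data.Bool.Base using (Bool; true; false; if_then_else_; T)
  open import Data.Fin.Base using (Fin; zero; suc; toℕ)
  import Data.Fin.Properties as Fin
  open import Data.Fin.Patterns
  open import Data.Fin.Subset using (Subset; _∩_; Nonempty) renaming (∣_∣ to ∣_∣ˢ)
  open import Data.Vec.Base as Vec using (Vec; []; _∷_)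
  open import Data.List.Base using (tabulate)
  open import Data.Product.Base using (_×_; _,_; ∃-syntax; proj₁; proj₂)
  open import Function.Base using (_∘_)
  open import Relation.Binary.PropositionalEquality hiding ([_])
  open import Relation.Nullary using (yes; no; does; contradiction; ¬_)
  open import Relation.Nullary.Construct.Add.Supremum using (_⁺; ⊤⁺; [_])
  open import Relation.Binary.Construct.Add.Supremum.NonStrict ℚ._≤_ using (_≤⁺_; [_]; _≤⊤⁺; ≤⁺-trans)

  open Bounded dividePairs

  Fraction : Set
  Fraction = ℕ × ℕ

  -- Numerators are positive because test costs are. This makes cross-multiplication order the
  -- fractions correctly even when a denominator is 0, whereas 0 / 0 would compare as equal to
  -- everything.
  data Represents : Fraction → ℚ ⁺ → Set where
    infinite : ∀ {p} → Represents (suc p , 0) ⊤⁺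
    finite   : ∀ {p q x} → x ℚ.* fromℕ (suc q) ≡ fromℕ (suc p) → Represents (suc p , suc q) [ x ]

  _≤ᶠ_ : Fraction → Fraction → Bool
  (p , q) ≤ᶠ (p′ , q′) = p * q′ ≤ᵇ p′ * q

  ≤-cross : ∀ {p q p′ q′ x x′} → x ℚ.* fromℕ (suc q) ≡ fromℕ p → x′ ℚ.* fromℕ (suc q′) ≡ fromℕ p′ →
            p * suc q′ ≤ p′ * suc q → x ℚ.≤ x′
  ≤-cross {p} {q} {p′} {q′} {x} {x′} eq eq′ cross = cancelʳ-fromℕ-suc q (cancelʳ-fromℕ-suc q′ (begin
    x ℚ.* fromℕ (suc q) ℚ.* fromℕ (suc q′)     ≡⟨ cong (ℚ._* fromℕ (suc q′)) eq ⟩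
    fromℕ p ℚ.* fromℕ (suc q′)                 ≡⟨ sym (fromℕ-* p (suc q′)) ⟩
    fromℕ (p * suc q′)                         ≤⟨ fromℕ-mono cross ⟩
    fromℕ (p′ * suc q)                         ≡⟨ fromℕ-* p′ (suc q) ⟩
    fromℕ p′ ℚ.* fromℕ (suc q)                 ≡⟨ cong (ℚ._* fromℕ (suc q)) (sym eq′) ⟩
    x′ ℚ.* fromℕ (suc q′) ℚ.* fromℕ (suc q)    ≡⟨ ℚ.*-assoc x′ _ _ ⟩
    x′ ℚ.* (fromℕ (suc q′) ℚ.* fromℕ (suc q))  ≡⟨ cong (x′ ℚ.*_) (ℚ.*-comm (fromℕ (suc q′)) (fromℕ (suc q))) ⟩
    x′ ℚ.* (fromℕ (suc q) ℚ.* fromℕ (suc q′))  ≡⟨ sym (ℚ.*-assoc x′ _ _) ⟩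
    x′ ℚ.* fromℕ (suc q) ℚ.* fromℕ (suc q′)    ∎))
    where open ℚ.≤-Reasoning

  Represents-≤ : ∀ {f f′ r r′} → Represents f r → Represents f′ r′ →
                 proj₁ f * proj₂ f′ ≤ proj₁ f′ * proj₂ f → r ≤⁺ r′
  Represents-≤ infinite    infinite     _     = _ ≤⊤⁺
  Represents-≤ (finite _)  infinite     _     = _ ≤⊤⁺
  Represents-≤ {suc p , _} {suc p′ , _} infinite (finite _) cross =
    contradiction (≤-trans cross (≤-reflexive (*-zeroʳ (suc p′)))) λ ()
  Represents-≤ (finite {p} {q} eq) (finite {p′} {q′} eq′) cross =
    [ ≤-cross {suc p} {q} {suc p′} {q′} eq eq′ cross ]

  ≤ᶠ-true : ∀ {f f′ r r′} → Represents f r → Represents f′ r′ → f ≤ᶠ f′ ≡ true → r ≤⁺ r′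
  ≤ᶠ-true {f} {f′} rep rep′ eq = Represents-≤ rep rep′ (≤ᵇ⇒≤ _ _ (subst T (sym eq) _))

  ≤ᶠ-false : ∀ {f f′ r r′} → Represents f r → Represents f′ r′ → f ≤ᶠ f′ ≡ false → r′ ≤⁺ r
  ≤ᶠ-false {f} {f′} rep rep′ eq = Represents-≤ rep′ rep
    (<⇒≤ (≰⇒> λ cross → subst T eq (≤⇒≤ᵇ cross)))

  ≤⁺-refl : ∀ r → r ≤⁺ r
  ≤⁺-refl ⊤⁺    = _ ≤⊤⁺
  ≤⁺-refl [ x ] = [ ℚ.≤-refl ]

  Represents-pos : ∀ {f x} → Represents f [ x ] → 0ℚ ℚ.≤ x
  Represents-pos {suc p , suc q} {x} (finite eq) = cancelʳ-fromℕ-suc q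
    (ℚ.≤-trans (ℚ.≤-reflexive (ℚ.*-zeroˡ (fromℕ (suc q)))) (subst (0ℚ ℚ.≤_) (sym eq) (0≤fromℕ (suc p))))

  maxᶠ : Fraction → Fraction → Fraction
  maxᶠ f f′ = if f ≤ᶠ f′ then f′ else f

  fraction : ℚ → ℕ → Fraction
  fraction c d = ∣ ↥ c ∣ , ↧ₙ c * d

  *-denominator : ∀ {c} → 0ℚ ℚ.≤ c → c ℚ.* fromℕ (↧ₙ c) ≡ fromℕ ∣ ↥ c ∣
  *-denominator {mkℚ -[1+ _ ] _ _} (ℚ.*≤* ())
  *-denominator {c@(mkℚ (+ p) d _)} _ = ℚ.toℚᵘ-injective
    (ℚᵘ.≃-trans (ℚ.toℚᵘ-homo-* c (fromℕ (suc d)))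
    (ℚᵘ.≃-trans (ℚᵘ.*-congˡ {ℚ.toℚᵘ c} (ℚ.toℚᵘ-fromℚᵘ (mkℚᵘ (+ suc d) 0)))
    (ℚᵘ.≃-trans (*≡* (trans (ℤ.*-identityʳ _) (cong (+ p ℤ.*_) (cong +_ (sym (*-identityʳ (suc d)))))))
    (ℚᵘ.≃-sym (ℚ.toℚᵘ-fromℚᵘ (mkℚᵘ (+ p) 0))))))

  module _ {ℓ} (I : Instance ℓ) where
    fraction-represents : ∀ {c} d → 0ℚ ℚ.< c → Represents (fraction c d) (divide I c d)
    fraction-represents {mkℚ -[1+ _ ] _ _} d (ℚ.*<* ())
    fraction-represents {mkℚ +0 _ _} d (ℚ.*<* (ℤ.+<+ ()))
    fraction-represents {mkℚ +[1+ _ ] d-1 _} zero 0<c rewrite *-zeroʳ d-1 = infinite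
    fraction-represents {c@(mkℚ +[1+ _ ] _ _)} (suc d) 0<c = finite (begin
      c ℚ.* recip d ℚ.* fromℕ (↧ₙ c * suc d)               ≡⟨ cong (c ℚ.* recip d ℚ.*_)
                                                                (trans (cong fromℕ (*-comm (↧ₙ c) (suc d))) (fromℕ-* (suc d) (↧ₙ c))) ⟩
      c ℚ.* recip d ℚ.* (fromℕ (suc d) ℚ.* fromℕ (↧ₙ c))   ≡⟨ sym (ℚ.*-assoc (c ℚ.* recip d) _ _) ⟩
      c ℚ.* recip d ℚ.* fromℕ (suc d) ℚ.* fromℕ (↧ₙ c)     ≡⟨ cong (ℚ._* fromℕ (↧ₙ c)) (recip-cancel c d) ⟩
      c ℚ.* fromℕ (↧ₙ c)                                   ≡⟨ *-denominator (ℚ.<⇒≤ 0<c) ⟩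
      fromℕ ∣ ↥ c ∣                                        ∎)
      where open ≡-Reasoning

    maxᶠ-represents : ∀ {f f′ r r′} → Represents f r → Represents f′ r′ → Represents (maxᶠ f f′) (_⊔⁺_ I r r′)
    maxᶠ-represents {f} {f′} {r} {r′} rep rep′ with f ≤ᶠ f′ in eq
    ... | true  = subst (Represents f′) (sym (⊔≡right r r′ (≤ᶠ-true rep rep′ eq))) rep′
      where
      ⊔≡right : ∀ r r′ → r ≤⁺ r′ → _⊔⁺_ I r r′ ≡ r′
      ⊔≡right [ x ] [ y ] [ x≤y ] = cong [_] (ℚ.p≤q⇒p⊔q≡q x≤y)
      ⊔≡right [ _ ] ⊤⁺    _       = refl
      ⊔≡right ⊤⁺    ⊤⁺    _       = refl
    ... | false = subst (Represents f) (sym (⊔≡left r r′ (≤ᶠ-false rep rep′ eq))) rep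
      where
      ⊔≡left : ∀ r r′ → r′ ≤⁺ r → _⊔⁺_ I r r′ ≡ r
      ⊔≡left [ x ] [ y ] [ y≤x ] = cong [_] (ℚ.p≥q⇒p⊔q≡p y≤x)
      ⊔≡left ⊤⁺    _     _       = refl

    -- `maxRatio` folds from 0 while the program takes the larger of two fractions; a represented
    -- value is nonnegative and absorbs the 0.
    ⊔0-represents : ∀ {f r} → Represents f r → Represents f (_⊔⁺_ I r [ 0ℚ ])
    ⊔0-represents {f} {⊤⁺}    rep = rep
    ⊔0-represents {f} {[ x ]} rep = subst (λ z → Represents f [ z ]) (sym (ℚ.p≥q⇒p⊔q≡p (Represents-pos rep))) rep

  encFraction : Fraction → Value
  encFraction (p , q) = pair (nat p) (nat q)

  ∣branches∣ : ∀ {n} (G : Subset n) (f : Fin n → Fin 2) →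
    ∣ G ∩ Vec.tabulate (λ s → does (f s Fin.≟ 0F)) ∣ˢ + ∣ G ∩ Vec.tabulate (λ s → does (f s Fin.≟ 1F)) ∣ˢ ≡ ∣ G ∣ˢ
  ∣branches∣ []          f = refl
  ∣branches∣ (false ∷ G) f = ∣branches∣ G (f ∘ suc)
  ∣branches∣ (true  ∷ G) f with f zero
  ... | 0F = cong suc (∣branches∣ G (f ∘ suc))
  ... | 1F = trans (+-suc _ _) (cong suc (∣branches∣ G (f ∘ suc)))

  module _ (I : Instance 2) where
    open Instance I

    maxFraction : Subset n → Fin k → Fraction
    maxFraction G t =
      maxᶠ (fraction (testCost t 0F) (separatedBy I G t 0F)) (fraction (testCost t 1F) (separatedBy I G t 1F))

    maxFraction-represents : ∀ G t → Represents (maxFraction G t) (maxRatio I G t)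
    maxFraction-represents G t = maxᶠ-represents I
      (fraction-represents I (separatedBy I G t 0F) (testCost-positive t 0F))
      (⊔0-represents I (fraction-represents I (separatedBy I G t 1F) (testCost-positive t 1F)))

    encTests : ∀ {j} → (Fin j → Fin k) → Value
    encTests τ = encList (tabulate λ i → encTest I (τ i))

    -- `τ` enumerates the suffix of the tests on which `selectᶠ` is called, and indices are relative
    -- to it. The empty suffix is given the fraction 1 / 0 and so compares as +∞.
    data Best (G : Subset n) {j} (τ : Fin j → Fin k) : ℕ → Value → Fraction → Set where
      none : j ≡ 0 → Best G τ 0 (nat 0) (1 , 0)
      some : (i : Fin j) → (∀ i′ → maxRatio I G (τ i) ≤⁺ maxRatio I G (τ i′)) →
             Best G τ (toℕ i) (encTest I (τ i)) (maxFraction G (τ i))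

    Best-index : ∀ {G j} {τ : Fin j → Fin k} {i v f} → Best G τ i v f → i ≤ j
    Best-index (none _)   = z≤n
    Best-index (some i _) = <⇒≤ (Fin.toℕ<n i)

    Best-minimal : ∀ {G j} {τ : Fin j → Fin k} {i v f} → Best G τ i v f →
                   ∃[ r ] Represents f r × (∀ i′ → r ≤⁺ maxRatio I G (τ i′))
    Best-minimal         (none refl)  = ⊤⁺ , infinite , λ ()
    Best-minimal {G} {τ = τ} (some i min) = maxRatio I G (τ i) , maxFraction-represents G (τ i) , min

    Best-keep : ∀ {G j} {τ : Fin (suc j) → Fin k} {i v f} → Best G (τ ∘ suc) i v f →
                maxFraction G (τ 0F) ≤ᶠ f ≡ true → Best G τ 0 (encTest I (τ 0F)) (maxFraction G (τ 0F))
    Best-keep {G} {τ = τ} best eq with Best-minimal best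
    ... | r , rep , r≤ = some 0F λ where
      0F      → ≤⁺-refl _
      (suc i) → ≤⁺-trans ℚ.≤-trans (≤ᶠ-true (maxFraction-represents G (τ 0F)) rep eq) (r≤ i)

    Best-skip : ∀ {G j} {τ : Fin (suc j) → Fin k} {i v f} → Best G (τ ∘ suc) i v f →
                maxFraction G (τ 0F) ≤ᶠ f ≡ false → Best G τ (i + 1) v f
    -- Every fraction compares as at most 1 / 0, so even a test of infinite ratio is preferred to
    -- the dummy of the empty suffix.
    Best-skip {G} {τ = τ} (none refl) eq = contradiction (trans (sym eq) 0≤ᵇ) λ ()
      where
      0≤ᵇ : maxFraction G (τ 0F) ≤ᶠ (1 , 0) ≡ true
      0≤ᵇ rewrite *-zeroʳ (proj₁ (maxFraction G (τ 0F))) = refl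
    Best-skip {G} {τ = τ} {f = f} (some i min) eq =
      subst (λ x → Best G τ x (encTest I (τ (suc i))) f) (+-comm 1 (toℕ i))
        (some (suc i) λ where
          0F       → ≤ᶠ-false (maxFraction-represents G (τ 0F)) (maxFraction-represents G (τ (suc i))) eq
          (suc i′) → min i′)

    module Simulation (M : ℕ) (1≤M : 1 ≤ M) (n≤M : n ≤ M) (k≤M : k ≤ M)
             (class≤M : ∀ s → bitLength (toℕ (class s)) ≤ M)
             (num≤M : ∀ t i → bitLength ∣ ↥ testCost t i ∣ ≤ M)
             (den≤M : ∀ t i → bitLength (↧ₙ testCost t i) ≤ M) where

      -- `suc w₀` is (M + 1)² and bounds the bit length of the products in `compareᶠ`: `M` for a
      -- numerator, `M` for the denominator of a cost and M² + 1 for a number of pairs. Every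
      -- further index adds a level of list traversal: `suc w₁` is the unit of a step of `pairsᶠ`,
      -- `suc w₂` of a ratio, `suc w₃` of a node.
      w₀ w₁ w₂ w₃ : ℕ
      w₀ = M * M + (M + M)
      w₁ = raise M w₀
      w₂ = raise M w₁
      w₃ = raise M w₂

      M²≤w₀ : M * M ≤ w₀
      M²≤w₀ = m≤m+n (M * M) (M + M)

      M≤w₀ : M ≤ w₀
      M≤w₀ = ≤-trans (m≤m+n M M) (m≤n+m (M + M) (M * M))

      w₀≤w₂ : w₀ ≤ w₂
      w₀≤w₂ = ≤-trans (w≤raise M w₀) (w≤raise M w₁)

      w₀≤w₃ : w₀ ≤ w₃
      w₀≤w₃ = ≤-trans w₀≤w₂ (w≤raise M w₂)

      M≤w₂ : M ≤ w₂
      M≤w₂ = ≤-trans M≤w₀ w₀≤w₂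

      P≤M² : ∀ G → P I G ≤ M * M
      P≤M² G = ≤-trans (P≤n² I G) (*-mono-≤ n≤M n≤M)

      P-runs : ∀ G → Runs pairsᶠ (encBits G ∷ encFins class ∷ []) (nat (P I G)) (suc n * (60 * suc w₁))
      P-runs G = subst (λ p → Runs pairsᶠ (encBits G ∷ encFins class ∷ []) (nat p) (suc n * (60 * suc w₁)))
        (sym (P≡countPairs I G))
        (pairs-runs M w₀ M²≤w₀ G class (λ s → ≤-trans (class≤M s) (≤-trans M≤w₀ (n≤1+n w₀))) n≤M)

      P-runs₂ : ∀ G → Runs pairsᶠ (encBits G ∷ encFins class ∷ []) (nat (P I G)) (suc n * (60 * suc w₂))
      P-runs₂ G = Runs-≤ (*-monoʳ-≤ (suc n) (*-monoʳ-≤ 60 (s≤s (w≤raise M w₁)))) (P-runs G)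

      Short : Fraction → Set
      Short (p , q) = bitLength p ≤ M × bitLength q ≤ M + suc (M * M)

      fraction-short : ∀ G t i → Short (fraction (testCost t i) (separatedBy I G t i))
      fraction-short G t i = num≤M t i ,
        ≤-trans (bitLength-* (↧ₙ testCost t i) (separatedBy I G t i))
          (+-mono-≤ (den≤M t i) (bitLength≤ (≤-trans (m∸n≤m (P I G) (P I (branch I G t i))) (P≤M² G))))

      ratio-short : ∀ G t → Short (maxFraction G t)
      ratio-short G t
        with fraction (testCost t 0F) (separatedBy I G t 0F) ≤ᶠ fraction (testCost t 1F) (separatedBy I G t 1F)
      ... | true  = fraction-short G t 1F
      ... | false = fraction-short G t 0F

      Best-short : ∀ {G j} {τ : Fin j → Fin k} {i v f} → Best G τ i v f → Short f
      Best-short (none _)                = 1≤M , ≤-trans 1≤M (m≤m+n M _)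
      Best-short {G} {τ = τ} (some i _) = ratio-short G (τ i)

      suc-w₀ : M + (M + suc (M * M)) ≡ suc w₀
      suc-w₀ = shuffle M
        where
        shuffle : ∀ M → M + (M + suc (M * M)) ≡ suc (M * M + (M + M))
        shuffle = solve-∀

      runs-const : ∀ {g ρ v} K w → Runs g ρ v (K * suc w + 0) → Runs g ρ v (K * suc w)
      runs-const K w = Runs-≤ (≤-reflexive (+-identityʳ _))

      compare-runs : ∀ {f f′} → Short f → Short f′ →
        Runs compareᶠ (encFraction f ∷ encFraction f′ ∷ []) (nat (if f ≤ᶠ f′ then 1 else 0)) (30 * suc w₂)
      compare-runs {p , q} {p′ , q′} (p≤ , q≤) (p′≤ , q′≤) = runs-const 30 w₂ (close 30 w₂ 0 0
        (evCase evVar (evCase evVar (evOp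
          (evOp evVar evVar (short {p} p≤) (short′ {q′} q′≤)) (evOp evVar evVar (short {p′} p′≤) (short′ {q} q≤))
          (product {p} {q′} p≤ q′≤) (product {p′} {q} p′≤ q≤)))))
        where
        short′ : ∀ {x} → bitLength x ≤ M + suc (M * M) → bitLength x ≤ suc w₂
        short′ x≤ = ≤-trans x≤ (≤-trans (m≤n+m _ M) (≤-trans (≤-reflexive suc-w₀) (s≤s w₀≤w₂)))
        short : ∀ {x} → bitLength x ≤ M → bitLength x ≤ suc w₂
        short {x} x≤ = short′ {x} (≤-trans x≤ (m≤m+n M _))
        product : ∀ {x y} → bitLength x ≤ M → bitLength y ≤ M + suc (M * M) → bitLength (x * y) ≤ suc w₂
        product {x} {y} x≤ y≤ = ≤-trans (bitLength-* x y)
          (≤-trans (+-mono-≤ x≤ y≤) (≤-trans (≤-reflexive suc-w₀) (s≤s w₀≤w₂)))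

      fraction-runs : ∀ i G t → Runs fractionᶠ
        (encFin i ∷ nat (P I G) ∷ encBits G ∷ encFins class ∷ encFins (outcome t) ∷ encℚ (testCost t i) ∷ [])
        (encFraction (fraction (testCost t i) (separatedBy I G t i))) (150 * suc w₂)
      fraction-runs i G t = runs-const 150 w₂ (close 150 w₂ 0 0
        (evCase evVar (evPair evVar (evOp evVar
          (evOp evVar
            (evTraverse 60 n≤M
              (evTraverse 20 n≤M (evVar ∷ᵉ evVar ∷ᵉ evVar ∷ᵉ []ᵉ) (restrict-runs w₁ i G (outcome t))
                ∷ᵉ evVar ∷ᵉ []ᵉ)
              (P-runs (branch I G t i)))
            (bitLength≤ (P≤w₂ G)) (bitLength≤ (P≤w₂ (branch I G t i))))
          (≤-trans (den≤M t i) (≤-trans M≤w₂ (n≤1+n w₂)))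
          (bitLength≤ (≤-trans (m∸n≤m (P I G) (P I (branch I G t i))) (P≤w₂ G)))))))
        where
        P≤w₂ : ∀ G → P I G ≤ w₂
        P≤w₂ G = ≤-trans (P≤M² G) (≤-trans M²≤w₀ w₀≤w₂)

      ratio-runs : ∀ G t → Runs ratioᶠ (nat (P I G) ∷ encBits G ∷ encFins class ∷ encTest I t ∷ [])
        (encFraction (maxFraction G t)) (400 * suc w₂)
      ratio-runs G t = runs-const 400 w₂ (close 400 w₂ 0 0
        (evCase evVar (evCase evVar (evCase evVar
          (evLet (evCall {k′ = 150} (evLit ∷ᵉ evVar ∷ᵉ evVar ∷ᵉ evVar ∷ᵉ evVar ∷ᵉ evVar ∷ᵉ []ᵉ)
            (fraction-runs 0F G t))
          (evLet (evCall {k′ = 150} (evLit ∷ᵉ evVar ∷ᵉ evVar ∷ᵉ evVar ∷ᵉ evVar ∷ᵉ evVar ∷ᵉ []ᵉ)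
            (fraction-runs 1F G t))
          (evValue (enc-if (f₀ ≤ᶠ f₁))
            (evIf (f₀ ≤ᶠ f₁) (evCall {k′ = 30} (evVar ∷ᵉ evVar ∷ᵉ []ᵉ)
                (compare-runs (fraction-short G t 0F) (fraction-short G t 1F)))
              evVar evVar))))))))
        where
        f₀ = fraction (testCost t 0F) (separatedBy I G t 0F)
        f₁ = fraction (testCost t 1F) (separatedBy I G t 1F)
        enc-if : ∀ b → (if b then encFraction f₁ else encFraction f₀) ≡ encFraction (if b then f₁ else f₀)
        enc-if true  = refl
        enc-if false = refl

      Selects : Subset n → ∀ {j} → (Fin j → Fin k) → ℕ → Value → Set
      Selects G {j} τ t out = Runs selectᶠ (nat (P I G) ∷ encBits G ∷ encFins class ∷ encTests τ ∷ []) out t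

      select-runs : ∀ G {j} (τ : Fin j → Fin k) → j ≤ M → ∃[ i ] ∃[ v ] ∃[ f ]
        Best G τ i v f × Selects G τ (suc j * (500 * suc w₂)) (pair (nat i) (pair v (encFraction f)))
      select-runs G {zero}  τ j≤M = 0 , nat 0 , (1 , 0) , none refl ,
        close 500 w₂ 0 0 (evNat evVar (evPair evLit (evPair evLit (evPair evLit evLit))))
      select-runs G {suc j} τ j<M with select-runs G (τ ∘ suc) (<⇒≤ j<M)
      ... | i , v , f , best , run = choose (f₀ ≤ᶠ f) refl (close 500 w₂ (suc j * (500 * suc w₂)) 0
        (evCase evVar
          (evLet (evCall {k′ = 400} (evVar ∷ᵉ evVar ∷ᵉ evVar ∷ᵉ evVar ∷ᵉ []ᵉ) (ratio-runs G (τ 0F)))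
          (evLet (evRec (evVar ∷ᵉ evVar ∷ᵉ evVar ∷ᵉ evVar ∷ᵉ []ᵉ) run)
          (evCase evVar (evCase evVar
            (evIf (f₀ ≤ᶠ f) (evCall {k′ = 30} (evVar ∷ᵉ evVar ∷ᵉ []ᵉ)
                (compare-runs (ratio-short G (τ 0F)) (Best-short best)))
              (evPair (evOp evVar evLit
                  (bitLength≤ (≤-trans (Best-index best) (≤-trans (<⇒≤ j<M) M≤w₂))) (bitLength-bit ≤-refl)) evVar)
              (evPair evLit (evPair evVar evVar)))))))))
        where
        f₀ = maxFraction G (τ 0F)
        -- `evIf` leaves the Boolean open, so one run serves both results of the comparison and is
        -- specialised here.
        choose : ∀ b → f₀ ≤ᶠ f ≡ b →
          Selects G τ (suc (suc j) * (500 * suc w₂))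
            (if b then pair (nat 0) (pair (encTest I (τ 0F)) (encFraction f₀))
                  else pair (nat (i + 1)) (pair v (encFraction f))) →
          ∃[ i ] ∃[ v ] ∃[ f ]
            Best G τ i v f × Selects G τ (suc (suc j) * (500 * suc w₂)) (pair (nat i) (pair v (encFraction f)))
        choose true  eq run = 0 , encTest I (τ 0F) , f₀ , Best-keep best eq , run
        choose false eq run = i + 1 , v , f , Best-skip best eq , run

      -- Pays for one node and its part of the output: 900 for `buildᶠ` apart from the recursive
      -- calls and 10 for the test index and the constructors, in multiples of `suc w₃`, rounded up.
      unit : ℕ
      unit = 1000 * suc w₃

      Builds : Subset n → Value → ℕ → Set
      Builds G out t = Runs buildᶠ (encBits G ∷ encFins class ∷ encTests (λ t → t) ∷ []) out t

      record Built (G : Subset n) : Set where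
        constructor built
        field
          tree   : DecTree I G
          greedy : DividePairs I tree
          {time} : ℕ
          run    : Builds G (encTree I tree) time
          -- The extra unit makes the bound additive over the two branches.
          bound  : time + size (encTree I tree) + unit ≤ ∣ G ∣ˢ * (2 * unit)

      build-leaf : ∀ {G} → Nonempty G → P I G ≡ 0 → Built G
      build-leaf {G} ne P≡0 = built (leaf j λ {s} → class≡j {s}) leaf
        (close 100 w₃ 0 0 (evLet
          (evTraverse 60 n≤M (evVar ∷ᵉ evVar ∷ᵉ []ᵉ) (P-runs₂ G))
          (evZero (evValue (cong nat P≡0) evVar)
            (evTraverse 20 n≤M (evVar ∷ᵉ evVar ∷ᵉ []ᵉ) (label-runs w₂ G class ne class≡j)))))
        (≤-trans (+-monoˡ-≤ unit (+-monoʳ-≤ (100 * suc w₃ + 0)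
                   (≤-trans (class≤M (proj₁ ne)) (≤-trans M≤w₀ (≤-trans w₀≤w₃ (n≤1+n w₃))))))
        (≤-trans (+-monoˡ-≤ unit (collect (suc w₃)))
        (≤-trans (≤-reflexive (cong (λ z → unit + z) (sym (+-identityʳ unit))))
          (≤-trans (≤-reflexive (sym (*-identityˡ (2 * unit))))
            (*-monoˡ-≤ (2 * unit) (nonempty⇒0<∣∣ (proj₂ ne)))))))
        where
        j = proj₁ (P≡0⇒Homogeneous I ne P≡0)
        class≡j = proj₂ (P≡0⇒Homogeneous I ne P≡0)
        collect : ∀ u → 100 * u + 0 + u ≤ 1000 * u
        collect u = ≤-trans (≤-reflexive (sum u)) (*-monoˡ-≤ u (≤ᵇ⇒≤ 101 1000 _))
          where
          sum : ∀ u → 100 * u + 0 + u ≡ 101 * u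
          sum = solve-∀

      build-node : ∀ {G} → Nonempty G → P I G ≢ 0 →
        (∀ {t} → Split I G t → ∀ i → Built (branch I G t i)) → Built G
      build-node {G} ne P≢0 recurse with select-runs G (λ t → t) k≤M
      -- Completeness provides a test as soon as `G` is not homogeneous.
      ... | _ , _ , _ , none k≡0 , _ = contradiction
        (subst Fin k≡0 (proj₁ (∃progress I ne λ hom → P≢0 (Homogeneous⇒P≡0 I hom)))) λ ()
      ... | _ , _ , _ , some t min , select = built (node ¬hom t child) (node min greedy)
        (close 900 w₃ (time B₀) (time B₁) (evLet
          (evTraverse 60 n≤M (evVar ∷ᵉ evVar ∷ᵉ []ᵉ) (P-runs₂ G))
          (nonzero (P I G) P≢0 evVar (evCase
            (evTraverse 500 k≤M (evVar ∷ᵉ evVar ∷ᵉ evVar ∷ᵉ evVar ∷ᵉ []ᵉ) select)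
            (evCase evVar (evCase evVar (evPair evVar
              (evPair (evPair (evRec
                  (evTraverse 20 n≤M (evLit ∷ᵉ evVar ∷ᵉ evVar ∷ᵉ []ᵉ) (restrict-runs w₂ 0F G (outcome t))
                    ∷ᵉ evVar ∷ᵉ evVar ∷ᵉ []ᵉ) (run B₀)) evLit)
              (evPair (evPair (evRec′
                  (evTraverse 20 n≤M (evLit ∷ᵉ evVar ∷ᵉ evVar ∷ᵉ []ᵉ) (restrict-runs w₂ 1F G (outcome t))
                    ∷ᵉ evVar ∷ᵉ evVar ∷ᵉ []ᵉ) (run B₁)) evLit)
                evLit)))))))))
        (≤-trans (+-monoˡ-≤ unit (+-monoʳ-≤ (900 * suc w₃ + (time B₁ + time B₀)) (s≤s (+-monoˡ-≤ _ index≤))))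
        (≤-trans (collect (suc w₃) unit (time B₀) (time B₁)
                   (size (encTree I (tree B₀))) (size (encTree I (tree B₁))) (s≤s z≤n) (units (suc w₃)))
        (≤-trans (+-mono-≤ (bound B₀) (bound B₁))
          (≤-reflexive (trans (sym (*-distribʳ-+ (2 * unit) ∣ branch I G t 0F ∣ˢ ∣ branch I G t 1F ∣ˢ))
            (cong (_* (2 * unit)) (∣branches∣ G (outcome t))))))))
        where
        open Built using (tree; time; run; bound)
        ¬hom : ¬ Homogeneous I G
        ¬hom hom = P≢0 (Homogeneous⇒P≡0 I hom)
        split : Split I G t
        split = P<⇒Split I (maxRatio-finite⇒P< I (proj₂ (DividePairs-node-finite I ne ¬hom min)))
        B₀ = recurse split 0F
        B₁ = recurse split 1F
        child : ∀ i → Child I (branch I G t i)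
        child 0F = present (split 0F) (tree B₀)
        child 1F = present (split 1F) (tree B₁)
        greedy : ∀ i → DividePairsChild I (child i)
        greedy 0F = present (Built.greedy B₀)
        greedy 1F = present (Built.greedy B₁)
        index≤ : bitLength (toℕ t) ≤ suc w₃
        index≤ = bitLength≤ (≤-trans (<⇒≤ (Fin.toℕ<n t)) (≤-trans k≤M (≤-trans M≤w₀ w₀≤w₃)))
        nonzero : ∀ p → p ≢ 0 → ∀ {w r r′ Γ} {ρ : Vec Value Γ} {e e₁ e₂ v k a b k′ a′ b′} →
          Ev {w} {r} {r′} ρ e (nat p) k a b → Ev {w} {r} {r′} ρ e₂ v k′ a′ b′ →
          Ev {w} {r} {r′} ρ (ifz e e₁ e₂) v (1 + (k + k′)) (a + a′) (b + b′)
        nonzero zero    p≢0 d d₂ = contradiction refl p≢0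
        nonzero (suc p) p≢0 d d₂ = evSuc d d₂
        units : ∀ u → 900 * u + (u + 9 * u) ≤ 1000 * u
        units u = ≤-trans (≤-reflexive (sum u)) (*-monoˡ-≤ u (≤ᵇ⇒≤ 910 1000 _))
          where
          sum : ∀ u → 900 * u + (u + 9 * u) ≡ 910 * u
          sum = solve-∀
        -- Besides the index and the two subtrees, the written node has five pairs and three empty
        -- lists; their total size 8 is within `9 * u`.
        collect : ∀ u U t₀ t₁ s₀ s₁ → 1 ≤ u → 900 * u + (u + 9 * u) ≤ U →
          900 * u + (t₁ + t₀) + suc (u + suc (suc (s₀ + 1) + suc (suc (s₁ + 1) + 1))) + U ≤
          (t₀ + s₀ + U) + (t₁ + s₁ + U)
        collect u U t₀ t₁ s₀ s₁ 1≤u u≤U = ≤-trans (≤-reflexive (regroup (900 * u) u U t₀ t₁ s₀ s₁))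
          (≤-trans (+-monoʳ-≤ (t₀ + s₀ + U + (t₁ + s₁))
                     (≤-trans (+-monoʳ-≤ (900 * u) (+-monoʳ-≤ u (*-mono-≤ {8} {9} (n≤1+n 8) 1≤u))) u≤U))
            (≤-reflexive (+-assoc (t₀ + s₀ + U) (t₁ + s₁) U)))
          where
          regroup : ∀ z u U t₀ t₁ s₀ s₁ →
            z + (t₁ + t₀) + suc (u + suc (suc (s₀ + 1) + suc (suc (s₁ + 1) + 1))) + U ≡
            t₀ + s₀ + U + (t₁ + s₁) + (z + (u + 8))
          regroup = solve-∀

      build-runs : ∀ N {G} → ∣ G ∣ˢ ≤ N → Nonempty G → Built G
      build-runs N {G} ∣G∣≤N ne with P I G ≟ 0
      ... | yes P≡0 = build-leaf ne P≡0
      build-runs zero    ∣G∣≤0 ne | no P≢0 = contradiction ∣G∣≤0 (<⇒≱ (nonempty⇒0<∣∣ (proj₂ ne)))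
      build-runs (suc N) ∣G∣≤N ne | no P≢0 = build-node ne P≢0 λ split i →
        build-runs N (≤-pred (≤-trans (Split⇒∣branch∣< I split i) ∣G∣≤N)) (split i)

-- A polynomial bound in the size of the encoded instance

module Output where
  open Rationals hiding (*-mono-≤)
  open Logarithm
  open SeparatedPairs
  open Approximation
  open Optimum
  open BoundedEvaluation
  open ListPrograms
  open Implementation
  open import Data.Nat.Base as ℕ hiding (∣_-_∣)
  open import Data.Nat.Properties
  open import Data.Nat.Tactic.RingSolver using (solve-∀)
  open import Data.Integer.Base using (∣_∣)
  open import Data.Rational.Base as ℚ using (ℚ; 0ℚ; 1ℚ; ↥_)
  import Data.Rational.Properties as ℚ
  open import Data.Rational.Solver using (module +-*-Solver)
  open import Data.Fin.Base using (Fin; zero; suc)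
  open import Data.Fin.Subset using (⊤; Nonempty) renaming (∣_∣ to ∣_∣ˢ)
  open import Data.Fin.Subset.Properties using (∈⊤; ∣p∣≤n)
  open import Data.List.Base using (tabulate)
  open import Data.Vec.Base using ([]; _∷_)
  open import Data.Product.Base using (_,_)
  open import Function.Base using (_∘_)
  open import Relation.Binary.PropositionalEquality

  size-pos : ∀ v → 1 ≤ size v
  size-pos (nat _)    = s≤s z≤n
  size-pos (pair _ _) = s≤s z≤n

  size-element : ∀ {n} (f : Fin n → Value) i → size (f i) ≤ size (encList (tabulate f))
  size-element f zero    = m≤n⇒m≤1+n (m≤m+n (size (f zero)) _)
  size-element f (suc i) = m≤n⇒m≤1+n (≤-trans (size-element (f ∘ suc) i) (m≤n+m _ (size (f zero))))

  length≤size : ∀ {n} (f : Fin n → Value) → n ≤ size (encList (tabulate f))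
  length≤size {zero}  f = z≤n
  length≤size {suc n} f = s≤s (≤-trans (length≤size (f ∘ suc)) (m≤n+m _ (size (f zero))))

  -- The empty sum is 0, so probabilities of total 1 force an object to exist, which the root of the
  -- output tree and the bound by ln n rely on.
  sumℚ-inhabited : ∀ {n} (p : Fin n → ℚ) → sumℚ (tabulate p) ≡ 1ℚ → Fin n
  sumℚ-inhabited {zero}  p ()
  sumℚ-inhabited {suc n} p _ = zero

  module _ (I : Instance 2) where
    open Instance I

    nonempty-⊤ : Nonempty (⊤ {n})
    nonempty-⊤ = sumℚ-inhabited prob prob-total , ∈⊤

    M : ℕ
    M = size (encInstance I)

    classes≤M : size (encFins class) ≤ M
    classes≤M = m≤n⇒m≤1+n (m≤m+n (size (encFins class)) _)

    tests≤M : size (encTests I (λ t → t)) ≤ M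
    tests≤M = m≤n⇒m≤1+n (≤-trans
      (m≤n⇒m≤1+n (m≤n+m _ (size (encList (tabulate (encℚ ∘ prob)))))) (m≤n+m _ (size (encFins class))))

    testCost≤M : ∀ t i → size (encℚ (testCost t i)) ≤ M
    testCost≤M t i = ≤-trans (size-element (encℚ ∘ testCost t) i)
      (≤-trans (m≤n⇒m≤1+n (m≤n+m _ (size (encFins (outcome t)))))
      (≤-trans (size-element (encTest I) t) tests≤M))

    open Simulation I M (size-pos (encInstance I))
      (≤-trans (length≤size (encFin ∘ class)) classes≤M)
      (≤-trans (length≤size (encTest I)) tests≤M)
      (λ s → ≤-trans (size-element (encFin ∘ class) s) classes≤M)
      (λ t i → ≤-trans (m≤n⇒m≤1+n (m≤m+n _ _)) (testCost≤M t i))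
      (λ t i → ≤-trans (m≤n⇒m≤1+n (m≤n+m _ (bitLength ∣ ↥ testCost t i ∣))) (testCost≤M t i))

    n≤M : n ≤ M
    n≤M = ≤-trans (length≤size (encFin ∘ class)) classes≤M

    result : Built ⊤
    result = build-runs n (∣p∣≤n ⊤) nonempty-⊤

    output : DecTree I ⊤
    output = Built.tree result

    output-greedy : DividePairs I output
    output-greedy = Built.greedy result

    open Bounded dividePairs

    main-runs : Ev {w₃} {Built.time result} {0} 
      (encInstance I ∷ []) (Program.main dividePairs) (encTree I output) 100 1 0
    main-runs = evWeaken {k = _} {a = _} {b = _} (≤ᵇ⇒≤ _ 100 _) (≤ᵇ⇒≤ _ 1 _) z≤n
      (evCase evVar (evCase evVar (evRec
        (evTraverse {M} {w₂} 10 n≤M (evVar ∷ᵉ []ᵉ) (ones-runs w₂ class) ∷ᵉ evVar ∷ᵉ evVar ∷ᵉ []ᵉ)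
        (Built.run result))))

    -- `suc (raise M w)` computes to `suc M * suc w`, so `suc w₃` is the fifth power of `suc M`; the
    -- sixth factor stands for the number of objects, rounded up.
    unit-polynomial : suc M * suc w₃ ≡ suc M ^ 6
    unit-polynomial = trans (cong (λ u → suc M * (suc M * (suc M * (suc M * u)))) (suc-w₀′ M)) (power (suc M))
      where
      suc-w₀′ : ∀ M → suc (M * M + (M + M)) ≡ suc M * suc M
      suc-w₀′ = solve-∀
      power : ∀ N → N * (N * (N * (N * (N * N)))) ≡ N * (N * (N * (N * (N * (N * 1)))))
      power = solve-∀

    -- 128000 is 2000 times 2 ^ 6: each object accounts for two nodes of 1000 units, and M + 1 ≤ 2 M
    -- turns the sixth power of `suc M` into one of `M`.
    dividePairs-outputs : OutputsWithin dividePairs (128000 * M ^ 6) (encInstance I) (encTree I output)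
    dividePairs-outputs = Ev.steps main-runs , Ev.run main-runs , (begin
      Ev.steps main-runs + s                         ≤⟨ +-monoˡ-≤ s (Ev.bound main-runs) ⟩
      100 * u + (1 * t + 0) + s                      ≡⟨ regroup (100 * u) t s ⟩
      100 * u + (t + s)                              ≤⟨ +-monoʳ-≤ (100 * u) (m+n≤o⇒m≤o (t + s) (Built.bound result)) ⟩
      100 * u + ∣ ⊤ {n} ∣ˢ * (2 * (1000 * u))        ≤⟨ +-monoʳ-≤ (100 * u) (*-monoˡ-≤ (2 * (1000 * u)) ∣⊤∣≤M) ⟩
      -- The initial 100 units are rounded up to the share of one more object, which completes `M`
      -- to `suc M`.
      100 * u + M * (2 * (1000 * u))                 ≤⟨ +-monoˡ-≤ (M * (2 * (1000 * u))) (*-monoˡ-≤ u (≤ᵇ⇒≤ 100 2000 _)) ⟩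
      2000 * u + M * (2 * (1000 * u))                ≡⟨ collect M u ⟩
      2000 * (suc M * u)                             ≡⟨ cong (2000 *_) unit-polynomial ⟩
      2000 * suc M ^ 6                               ≤⟨ *-monoʳ-≤ 2000 (^-monoˡ-≤ 6 suc-M≤2M) ⟩
      2000 * (2 * M) ^ 6                             ≡⟨ cong (2000 *_) (double-power M 6) ⟩
      2000 * (64 * M ^ 6)                            ≡⟨ sym (*-assoc 2000 64 (M ^ 6)) ⟩
      128000 * M ^ 6                                 ∎)
      where
      open ≤-Reasoning
      u = suc w₃
      t = Built.time result
      s = size (encTree I output)
      regroup : ∀ z t s → z + (1 * t + 0) + s ≡ z + (t + s)
      regroup = solve-∀
      collect : ∀ M u → 2000 * u + M * (2 * (1000 * u)) ≡ 2000 * (suc M * u)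
      collect = solve-∀
      ∣⊤∣≤M : ∣ ⊤ {n} ∣ˢ ≤ M
      ∣⊤∣≤M = ≤-trans (∣p∣≤n (⊤ {n})) n≤M
      suc-M≤2M : suc M ≤ 2 * M
      suc-M≤2M = +-mono-≤ (size-pos (encInstance I)) (m≤m+n M 0)
      double : ∀ M c x → 2 * M * (c * x) ≡ 2 * c * (M * x)
      double = solve-∀
      double-power : ∀ M k → (2 * M) ^ k ≡ 2 ^ k * M ^ k
      double-power M zero    = refl
      double-power M (suc k) = trans (cong (2 * M *_) (double-power M k)) (double M (2 ^ k) (M ^ k))

    H-ln : ∀ {opt} → 0ℚ ℚ.≤ opt → H (P I ⊤) ℚ.* opt ≤ fromℕ 2 ℚ.* opt ·ln n
    H-ln {opt} 0≤opt u ln<u = ℚ.≤-trans (*-monoʳ 0≤opt (H≤2ln {n} {P I ⊤} (1+2P≤n² I ⊤ nonempty-⊤) u ln<u))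
      (ℚ.≤-reflexive (solveℚ 3 (λ a u o → a :* u :* o := a :* o :* u) refl (fromℕ 2) u opt))
      where open +-*-Solver using (_:=_; _:*_) renaming (solve to solveℚ)

import Data.Rational.Properties as ℚ
open Approximation using (0≤costW; DividePairs-approx)
open Optimum using (optimalTree)
open BoundedEvaluation using (dividePairs)
open Output using (nonempty-⊤; output; output-greedy; dividePairs-outputs; H-ln)

theorem1 : Σ[ A ∈ Program ] Σ[ a ∈ ℕ ] Σ[ d ∈ ℕ ] Σ[ C ∈ ℕ ]
    ((I : Instance 2) → let open Instance I using (n) in
    ∃[ opt ] IsOPTW I ⊤ opt
    × (Σ[ D ∈ DecTree I ⊤ ]
    OutputsWithin A (a ℕ.* size (encInstance I) ℕ.^ d) (encInstance I) (encTree I D)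
    × DividePairs I D
    × costW I D ≤ fromℕ C ℚ.* opt ·ln n)
    × ((D : DecTree I ⊤) → DividePairs I D →
    costW I D ℚ.≤ H (P I ⊤) ℚ.* opt
    × H (P I ⊤) ℚ.* opt ≤ fromℕ 2 ℚ.* opt ·ln n))
theorem1 = dividePairs , 128000 , 6 , 2 , λ I →
  let D* , optimal = optimalTree I (Instance.n I) (∣p∣≤n ⊤) (nonempty-⊤ I)
      0≤opt        = 0≤costW I D*
      approx       = λ {D} → DividePairs-approx I D* {D}
  in costW I D* , ((D* , refl) , optimal)
   , (output I , dividePairs-outputs I , output-greedy I ,
      λ u ln<u → ℚ.≤-trans (approx (output-greedy I)) (H-ln I 0≤opt u ln<u))
   , λ D greedy → approx greedy , H-ln I 0≤opt
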